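{- Let $G=(V,E)$ be a directed graph with $V=\{1,\dots,N\}$ and $E\subseteq V^2$ (self-loops allowed), with labeled adjacency matrix $\mathsf W$. Let $\mathcal C$ be the set of all non-empty subsets $C\subseteq V$ such that the subgraph of $G$ induced by $C$ is weakly connected, and for $C\in\mathcal C$ let $N(C)$ be the weak neighborhood of $C$ in $G$. Let $\mathsf P_{\mathrm{op}}(z)$ and $\mathsf P_{\mathrm{cl}}(z)$ be the matrix generating series of the open simple paths and of the closed simple paths (simple cycles) of $G$, respectively. Then: (i) $$\mathsf P_{\mathrm{op}}(z)=\sum_{C\in\mathcal C}(z\mathsf W_C)^{|C|-1}(\mathsf I-z\mathsf W_C)^{|N(C)|};$$ (ii) $$\mathsf P_{\mathrm{cl}}(z)=\sum_{C\in\mathcal C}\operatorname{Diag}\Big((z\mathsf W_C)^{|C|}(\mathsf I-z\mathsf W_C)^{|N(C)|}\Big).$$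
   Context: Each arc $(i,j)\in E$ carries a label $\omega_{ij}$. The labeled adjacency matrix $\mathsf W$ is the $N\times N$ matrix with $\mathsf W_{ij}=\omega_{ij}$ if $(i,j)\in E$ and $\mathsf W_{ij}=0$ otherwise. $\mathsf I$ is the $N\times N$ identity matrix and $z$ is a formal variable. A path $p$ of length $\ell(p)=\ell\ge 1$ from $i$ to $j$ is a sequence of $\ell$ contiguous arcs (each new arc starts where the previous one ended), written $p=\omega_{ii_1}\omega_{i_1i_2}\cdots\omega_{i_{\ell-1}j}$. A path is open if its end vertices $i,j$ are different and closed (a cycle) otherwise. By convention, the empty path $1$ is considered a cycle of zero length. $V(p)$ is the set of vertices of $p$ and $|V(p)|$ its size. Simple paths are paths that do not visit the same vertex more than once (the start and end vertices of a closed path coinciding); they are characterized as the non-empty paths $p$ such that $\ell(p)=|V(p)|-1$ if $p$ is open and $\ell(p)=|V(p)|$ if $p$ is closed. In particular self-loops $\omega_{ii}$ and backtracks $\omega_{ij}\omega_{ji}$ are cycles of length $1$ and $2$. $\mathsf P(z)$ is the $N\times N$ matrix with entries $\mathsf P_{ij}(z)=\sum_{p:\,i\to j,\ p\text{ simple}}p\,z^{\ell(p)}$. For a square matrix $\mathsf M$, $\operatorname{Diag}(\mathsf M)$ is the diagonal matrix obtained by setting all off-diagonal entries of $\mathsf M$ to zero. Set $\mathsf P_{\mathrm{cl}}(z)=\operatorname{Diag}(\mathsf P(z))$ and $\mathsf P_{\mathrm{op}}(z)=\mathsf P(z)-\mathsf P_{\mathrm{cl}}(z)$. For an $N\times N$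 matrix $\mathsf M$ and a non-empty $S\subseteq V$, $\mathsf M_S$ is the $N\times N$ matrix with $(\mathsf M_S)_{ij}=\mathsf M_{ij}$ if $i,j\in S$ and $0$ otherwise. A digraph is weakly connected if replacing all its directed edges by undirected edges produces a connected undirected graph. The weak neighborhood of $C$ is $N(C)=\{i\in V\setminus C:\ \exists j\in C,\ (i,j)\in E\text{ and/or }(j,i)\in E\}$.
   Formalization: Identity (i) fails on the diagonal as written (for N=1 and no arcs, P_op=0 but the sum is I); it is proved with the correction P_op(z) = (the sum) − N·I, which changes only diagonal entries. Identity (ii) is proved as stated. -}

module Defs where

open import Algebra.Bundles using (RawRing)
import Algebra.Definitions.RawSemiring as RawSemiringDefs
open import Data.Bool.Base using (Bool; T)
open import Data.Bool.Properties using (T-irrelevant)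
open import Data.Fin.Base using (Fin; toℕ)
open import Data.Fin.Properties using (_≟_; any?; all?)
open import Data.Fin.Subset using (Subset; inside; outside; _∈_; _∉_; _∪_; ⁅_⁆; ∣_∣; Nonempty)
open import Data.Fin.Subset.Properties
  using (_∈?_; nonempty?; x∈⁅x⁆; x∈⁅y⁆⇒x≡y; x∈p∪q⁻; x∈p∪q⁺; p⊆p∪q; q⊆p∪q; ∣p∣≤n; p⊂q⇒∣p∣<∣q∣)
open import Data.List.Base using (List; []; _∷_; _++_; map; filter; foldr; concatMap; allFin; _∷ʳ_)
import Data.List.Membership.Propositional as List∈
open import Data.List.Membership.Propositional.Properties
  using (∈-map⁺; ∈-map⁻; ∈-++⁺ˡ; ∈-++⁺ʳ; ∈-concatMap⁺; ∈-allFin)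
open import Data.List.Relation.Binary.Disjoint.Propositional using (Disjoint)
open import Data.List.Relation.Unary.All as All using ()
import Data.List.Relation.Unary.All.Properties as All
open import Data.List.Relation.Unary.AllPairs as AllPairs using ()
import Data.List.Relation.Unary.AllPairs.Properties as AllPairs
open import Data.List.Relation.Unary.Any as Any using (here)
open import Data.List.Relation.Unary.Unique.Propositional using (Unique)
import Data.List.Relation.Unary.Unique.Propositional.Properties as Unique
import Data.List.Relation.Unary.Unique.DecPropositional as DecUnique
open import Data.Nat.Base as ℕ using (ℕ; zero; suc; _∸_; _≤_; _<_)
import Data.Nat.Properties as ℕ
open import Data.Product.Base using (∃; ∃₂; _×_; _,_)
open import Data.Sum.Base using (_⊎_; inj₁; inj₂)
open import Data.Vec.Base using ([]; _∷_; tabulate)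
open import Data.Vec.Properties using (∷-injectiveʳ)
open import Function.Base using (case_of_)
open import Level using (Level; 0ℓ)
open import Relation.Binary.Core using (Rel)
open import Relation.Binary.Definitions using (Decidable)
open import Relation.Binary.Construct.Closure.Equivalence using (EqClosure)
open import Relation.Binary.Construct.Closure.ReflexiveTransitive using (Star; ε; _◅_; _◅◅_)
open import Relation.Binary.Construct.Closure.Symmetric using (SymClosure; fwd; bwd)
open import Relation.Binary.PropositionalEquality using (_≡_; _≢_; refl; subst)
open import Relation.Nullary.Decidable
  using (Dec; yes; no; does; T?; ¬?; _×-dec_; _⊎-dec_; _→-dec_; map′)
open import Relation.Nullary.Negation using (contradiction)

private
  variable
    a c r : Level
    n N ℓ : ℕ

------------------------------------------------------------------------
-- Formal power series in a central variable, and square matrices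

module _ (R : RawRing c r) where
  open RawRing R
  open RawSemiringDefs rawSemiring using (sum)

  Series : Set c
  Series = ℕ → Carrier

  powerSeries : RawRing c r
  powerSeries = record
    { Carrier = Series
    ; _≈_     = λ f g → ∀ k → f k ≈ g k
    ; _+_     = λ f g k → f k + g k
    ; _*_     = λ f g k → sum {suc k} λ i → f (toℕ i) * g (k ∸ toℕ i)
    ; -_      = λ f k → - f k
    ; 0#      = λ _ → 0#
    ; 1#      = λ { zero → 1# ; (suc _) → 0# }
    }

  -- z ⟨ x ⟩ is the series x z.
  z⟨_⟩ : Carrier → Series
  z⟨ x ⟩ 1 = x
  z⟨ x ⟩ _ = 0#

  Matrix : ℕ → Set c
  Matrix n = Fin n → Fin n → Carrier

  Diag : Matrix n → Matrix n
  Diag M i j with i ≟ j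
  ... | yes _ = M i j
  ... | no  _ = 0#

  restrict : Subset n → Matrix n → Matrix n
  restrict S M i j with (i ∈? S) ×-dec (j ∈? S)
  ... | yes _ = M i j
  ... | no  _ = 0#

  identity : Matrix n
  identity i j with i ≟ j
  ... | yes _ = 1#
  ... | no  _ = 0#

  matrices : ℕ → RawRing c r
  matrices n = record
    { Carrier = Matrix n
    ; _≈_     = λ A B → ∀ i j → A i j ≈ B i j
    ; _+_     = λ A B i j → A i j + B i j
    ; _*_     = λ A B i j → sum λ k → A i k * B k j
    ; -_      = λ A i j → - A i j
    ; 0#      = λ _ _ → 0#
    ; 1#      = identity
    }

------------------------------------------------------------------------
-- Enumeration of subsets

subsets : ∀ n → List (Subset n)
subsets zero    = [] ∷ []
subsets (suc n) = map (outside ∷_) (subsets n) ++ map (inside ∷_) (subsets n)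

∈-subsets : (S : Subset n) → S List∈.∈ subsets n
∈-subsets []            = here refl
∈-subsets (outside ∷ S) = ∈-++⁺ˡ (∈-map⁺ (outside ∷_) (∈-subsets S))
∈-subsets (inside  ∷ S) = ∈-++⁺ʳ _ (∈-map⁺ (inside ∷_) (∈-subsets S))

subsets-unique : ∀ n → Unique (subsets n)
subsets-unique zero    = All.[] AllPairs.∷ AllPairs.[]
subsets-unique (suc n) = Unique.++⁺
  (Unique.map⁺ ∷-injectiveʳ (subsets-unique n))
  (Unique.map⁺ ∷-injectiveʳ (subsets-unique n))
  disjoint
  where
  disjoint : Disjoint (map (outside ∷_) (subsets n)) (map (inside ∷_) (subsets n))
  disjoint (S∈o , S∈i) with ∈-map⁻ (outside ∷_) S∈o | ∈-map⁻ (inside ∷_) S∈i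
  ... | _ , _ , refl | _ , _ , ()

------------------------------------------------------------------------
-- Reachability for a decidable relation on a finite set is decidable

module _ {_∼_ : Rel (Fin n) 0ℓ} (_∼?_ : Decidable _∼_) where

  private
    Closed : Subset n → Set
    Closed D = ∀ {x y} → x ∈ D → x ∼ y → y ∈ D

    Reached : Fin n → Subset n → Set
    Reached i D = ∀ {x} → x ∈ D → Star _∼_ i x

    step? : ∀ D → Dec (∃₂ λ x y → x ∈ D × y ∉ D × x ∼ y)
    step? D = any? λ x → any? λ y → (x ∈? D) ×-dec (¬? (y ∈? D) ×-dec (x ∼? y))

    grow : ∀ fuel i D → n < ∣ D ∣ ℕ.+ fuel → i ∈ D → Reached i D →
           ∃ λ D′ → i ∈ D′ × Reached i D′ × Closed D′
    grow zero i D n<∣D∣ _ _ =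
      contradiction (∣p∣≤n D) (ℕ.<⇒≱ (subst (n <_) (ℕ.+-identityʳ _) n<∣D∣))
    grow (suc fuel) i D n<s i∈D reached with step? D
    ... | no  ¬step = D , i∈D , reached , closed
      where
      closed : Closed D
      closed {x} {y} x∈D x∼y with y ∈? D
      ... | yes y∈D = y∈D
      ... | no  y∉D = contradiction (x , y , x∈D , y∉D , x∼y) ¬step
    ... | yes (x , y , x∈D , y∉D , x∼y) = grow fuel i (D ∪ ⁅ y ⁆) n<s′ (p⊆p∪q _ i∈D) reached′
      where
      ∣D∣<∣D∪y∣ : ∣ D ∣ < ∣ D ∪ ⁅ y ⁆ ∣
      ∣D∣<∣D∪y∣ = p⊂q⇒∣p∣<∣q∣ (p⊆p∪q ⁅ y ⁆ , y , q⊆p∪q D ⁅ y ⁆ (x∈⁅x⁆ y) , y∉D)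

      n<s′ : n < ∣ D ∪ ⁅ y ⁆ ∣ ℕ.+ fuel
      n<s′ = ℕ.<-≤-trans (subst (n <_) (ℕ.+-suc _ fuel) n<s) (ℕ.+-monoˡ-≤ fuel ∣D∣<∣D∪y∣)

      reached′ : Reached i (D ∪ ⁅ y ⁆)
      reached′ w∈ with x∈p∪q⁻ D ⁅ y ⁆ w∈
      ... | inj₁ w∈D = reached w∈D
      ... | inj₂ w∈y with x∈⁅y⁆⇒x≡y y w∈y
      ...   | refl = reached x∈D ◅◅ (x∼y ◅ ε)

    closed-star : ∀ {D} → Closed D → ∀ {x y} → x ∈ D → Star _∼_ x y → y ∈ D
    closed-star closed x∈D ε         = x∈D
    closed-star closed x∈D (s ◅ rest) = closed-star closed (closed x∈D s) rest

  star? : Decidable (Star _∼_)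
  star? i j
    with grow (suc n) i ⁅ i ⁆ (ℕ.m≤n+m (suc n) _) (x∈⁅x⁆ i)
              (λ x∈ → case x∈⁅y⁆⇒x≡y i x∈ of λ { refl → ε })
  ... | D , i∈D , reached , closed =
    map′ reached (closed-star closed i∈D) (j ∈? D)

------------------------------------------------------------------------
-- Directed graphs

record Digraph (N : ℕ) : Set where
  field
    arc : Fin N → Fin N → Bool

  E : Rel (Fin N) 0ℓ
  E i j = T (arc i j)

  E? : Decidable E
  E? i j = T? (arc i j)

module _ (G : Digraph N) where
  open Digraph G

  Labelling : Set a → Set a
  Labelling A = ∀ {i j} → E i j → A

  Induced : Subset N → Rel (Fin N) 0ℓ
  Induced C i j = i ∈ C × j ∈ C × E i j

  WeaklyConnected : Subset N → Set
  WeaklyConnected C = ∀ i j → i ∈ C → j ∈ C → EqClosure (Induced C) i j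

  weaklyConnected? : ∀ C → Dec (WeaklyConnected C)
  weaklyConnected? C =
    all? λ i → all? λ j → (i ∈? C) →-dec ((j ∈? C) →-dec star? sym? i j)
    where
    induced? : Decidable (Induced C)
    induced? i j = (i ∈? C) ×-dec ((j ∈? C) ×-dec E? i j)

    sym? : Decidable (SymClosure (Induced C))
    sym? i j = map′ (λ { (inj₁ e) → fwd e ; (inj₂ e) → bwd e })
                    (λ { (fwd e) → inj₁ e ; (bwd e) → inj₂ e })
                    (induced? i j ⊎-dec induced? j i)

  connectedSubsets : List (Subset N)
  connectedSubsets = filter (λ C → nonempty? C ×-dec weaklyConnected? C) (subsets N)

  IsNeighbour : Subset N → Fin N → Set
  IsNeighbour C i = i ∉ C × ∃ λ j → j ∈ C × (E i j ⊎ E j i)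

  isNeighbour? : ∀ C i → Dec (IsNeighbour C i)
  isNeighbour? C i =
    ¬? (i ∈? C) ×-dec any? λ j → (j ∈? C) ×-dec (E? i j ⊎-dec E? j i)

  neighbourhood : Subset N → Subset N
  neighbourhood C = tabulate λ i → does (isNeighbour? C i)

------------------------------------------------------------------------
-- Paths, indexed by length, start vertex and end vertex

  infixr 5 _∷_

  data Path : ℕ → Fin N → Fin N → Set where
    []  : ∀ {i} → Path 0 i i
    _∷_ : ∀ {ℓ i k j} → E i k → Path ℓ k j → Path (suc ℓ) i j

  sources : ∀ {i j} → Path ℓ i j → List (Fin N)
  sources []              = []
  sources (_∷_ {i = i} e p) = i ∷ sources p

  vertices : ∀ {i j} → Path ℓ i j → List (Fin N)
  vertices {j = j} p = sources p ∷ʳ j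

  -- In a closed path the common start and end vertex is counted once.
  Simple : ∀ {i j} → Path ℓ i j → Set
  Simple {ℓ = ℓ} {i} {j} p =
    1 ≤ ℓ × (i ≢ j → Unique (vertices p)) × (i ≡ j → Unique (sources p))

  simple? : ∀ {i j} (p : Path ℓ i j) → Dec (Simple p)
  simple? {ℓ = ℓ} {i} {j} p =
    (1 ℕ.≤? ℓ) ×-dec
    ((¬? (i ≟ j) →-dec unique? (vertices p)) ×-dec ((i ≟ j) →-dec unique? (sources p)))
    where open DecUnique _≟_ using (unique?)

  consPaths : ∀ {i k j} → Dec (E i k) → List (Path ℓ k j) → List (Path (suc ℓ) i j)
  consPaths (yes e) ps = map (e ∷_) ps
  consPaths (no  _) ps = []

  paths : ∀ ℓ i j → List (Path ℓ i j)
  paths zero i j with i ≟ j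
  ... | yes refl = [] ∷ []
  ... | no  _    = []
  paths (suc ℓ) i j = concatMap (λ k → consPaths (E? i k) (paths ℓ k j)) (allFin N)

  simplePaths : ∀ ℓ i j → List (Path ℓ i j)
  simplePaths ℓ i j = filter simple? (paths ℓ i j)

  ∈-paths : ∀ {i j} (p : Path ℓ i j) → p List∈.∈ paths ℓ i j
  ∈-paths {i = i} [] with i ≟ i
  ... | yes refl = here refl
  ... | no  i≢i  = contradiction refl i≢i
  ∈-paths {i = i} {j} (_∷_ {ℓ = ℓ} {k = k} e p) =
    ∈-concatMap⁺ (λ k → consPaths (E? i k) (paths ℓ k j))
      (Any.map (λ { refl → ∈-cons (E? i k) }) (∈-allFin k))
    where
    ∈-cons : (d : Dec (E i k)) → (e ∷ p) List∈.∈ consPaths d (paths ℓ k j)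
    ∈-cons (no  ¬e) = contradiction e ¬e
    ∈-cons (yes e′) with T-irrelevant e e′
    ... | refl = ∈-map⁺ (e ∷_) (∈-paths p)

  paths-unique : ∀ ℓ i j → Unique (paths ℓ i j)
  paths-unique zero i j with i ≟ j
  ... | yes refl = All.[] AllPairs.∷ AllPairs.[]
  ... | no  _    = AllPairs.[]
  paths-unique (suc ℓ) i j = Unique.concat⁺
    (All.map⁺ (All.universal (λ k → cons-unique (E? i k)) (allFin N)))
    (AllPairs.map⁺ (AllPairs.map (λ k≢l {v} → disjoint (E? i _) (E? i _) k≢l {v}) (Unique.allFin⁺ N)))
    where
    cons-injective : ∀ {k} {e : E i k} {p q : Path ℓ k j} → _≡_ {A = Path (suc ℓ) i j} (e ∷ p) (e ∷ q) → p ≡ q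
    cons-injective refl = refl

    cons-unique : ∀ {k} (d : Dec (E i k)) → Unique (consPaths d (paths ℓ k j))
    cons-unique (yes e) = Unique.map⁺ cons-injective (paths-unique ℓ _ j)
    cons-unique (no  _) = AllPairs.[]

    disjoint : ∀ {k l} (d : Dec (E i k)) (d′ : Dec (E i l)) → k ≢ l →
               Disjoint (consPaths d (paths ℓ k j)) (consPaths d′ (paths ℓ l j))
    disjoint (yes e) (yes e′) k≢l (p∈ , p∈′) with ∈-map⁻ (e ∷_) p∈ | ∈-map⁻ (e′ ∷_) p∈′
    ... | _ , _ , refl | _ , _ , refl = k≢l refl

------------------------------------------------------------------------
-- The generating series of simple paths. The labels lie in a ring that
-- need not be commutative.

module Labelled (R : RawRing c r) (G : Digraph N) (ω : Labelling G (RawRing.Carrier R)) where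
  open Digraph G
  private module R = RawRing R

  W : Matrix R N
  W i j with E? i j
  ... | yes e = ω e
  ... | no  _ = R.0#

  -- The path itself, read as the product of its labels in order.
  weight : ∀ {i j} → Path G ℓ i j → R.Carrier
  weight []      = R.1#
  weight (e ∷ p) = ω e R.* weight p

  𝕄 : RawRing c r
  𝕄 = matrices (powerSeries R) N

  open RawRing 𝕄 public using (_≈_; _+_; _*_; -_; 0#) renaming (1# to I)
  open RawSemiringDefs (RawRing.rawSemiring 𝕄) public using (_^_) renaming (_×_ to _·_)

  infixl 6 _-_
  _-_ : RawRing.Carrier 𝕄 → RawRing.Carrier 𝕄 → RawRing.Carrier 𝕄
  A - B = A + - B

  ∑ : {A : Set a} → List A → (A → RawRing.Carrier 𝕄) → RawRing.Carrier 𝕄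
  ∑ xs f = foldr _+_ 0# (map f xs)

  syntax ∑ xs (λ x → e) = ∑[ x ← xs ] e

  diag : RawRing.Carrier 𝕄 → RawRing.Carrier 𝕄
  diag = Diag (powerSeries R)

  zW : Subset N → RawRing.Carrier 𝕄
  zW C i j = z⟨_⟩ R (restrict R C W i j)

  -- The third argument is the exponent of z: the coefficient of z^ℓ is the
  -- sum of the simple paths of length ℓ.
  P : RawRing.Carrier 𝕄
  P i j ℓ = foldr R._+_ R.0# (map weight (simplePaths G ℓ i j))

  Pcl : RawRing.Carrier 𝕄
  Pcl = diag P

  Pop : RawRing.Carrier 𝕄
  Pop = P - Pcl

{-# OPTIONS --safe #-}
-- Let every vertex be open with probability x. Given that a connected set S is open, its
-- open cluster is C ⊇ S with probability x^(|C| - |S|) (1 - x)^|N(C)|, and these sum to 1: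
--   Σ_{C ∈ 𝒞, S ⊆ C} x^|C| (1 - x)^|N(C)| = x^|S|,
-- proved by exploring the boundary of S one vertex at a time. On the other hand, the coefficient
-- of z^ℓ in (z W_C)^a (I - z W_C)^b is that of x^ℓ in x^a (1 - x)^b times the sum of the
-- paths of length ℓ inside C. Summing over C and exchanging the sums, a path p survives
-- with the coefficient of x^ℓ in x^(|V(p)| - 1), respectively x^|V(p)|, which
-- singles out the simple paths.

module Submission where

open import Defs
open import Algebra.Bundles using (RawRing; Ring)
import Algebra.Definitions.RawSemiring as RawSemiringDefs
import Algebra.Properties.CommutativeSemigroup as CommutativeSemigroupProperties
import Algebra.Properties.Semiring.Mult as MultProperties
import Algebra.Properties.Ring as RingProperties
import Algebra.Properties.Semiring.Sum as SumProperties
open import Data.Bool.Base using (if_then_else_; true; false)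
open import Data.Bool.Properties as Bool using (T-irrelevant)
open import Data.Empty using (⊥-elim)
open import Data.Fin.Base using (Fin; zero; suc; toℕ)
open import Data.Fin.Properties using (_≟_; any?; toℕ≤pred[n])
open import Data.Fin.Subset
  using (Subset; inside; outside; _∈_; _∉_; _⊆_; _∩_; _∪_; ⊥; ⊤; ⁅_⁆; ∣_∣; Nonempty)
  renaming (_-_ to _∖_)
open import Data.Fin.Subset.Properties
open import Data.List.Base
  using (List; []; _∷_; _++_; map; filter; foldr; concatMap; tabulate; length)
import Data.List.Membership.Propositional as List∈
open import Data.List.Membership.Propositional.Properties 
  using (∈-filter⁻; ∈-filter⁺; ∈-++⁺ˡ; ∈-++⁻)
open import Data.List.Properties using (map-∘)
open import Data.List.Relation.Unary.All as All using (All; []; _∷_)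
open import Data.List.Relation.Unary.Any using (here; there)
import Data.List.Relation.Unary.AllPairs as AllPairs
open import Data.List.Relation.Unary.Unique.Propositional using (Unique)
import Data.List.Relation.Unary.Unique.Propositional.Properties as Unique
open import Data.Nat.Base using (ℕ; zero; suc; _∸_; _≤_; z≤n; s≤s)
import Data.Nat.Base as ℕ
import Data.Nat.Properties as ℕ
open import Data.Product.Base using (∃; _×_; _,_; proj₁; proj₂)
open import Data.Sum.Base using (_⊎_; inj₁; inj₂; [_,_]′)
open import Data.Vec.Base using ([]; _∷_; here; there)
open import Data.Vec.Properties using ([]=⇒lookup; lookup⇒[]=; lookup∘tabulate; ≡-dec)
open import Function.Base using (_∘_; id; case_of_)
open import Level using (Level)
open import Relation.Binary.Construct.Closure.Equivalence using (EqClosure; symmetric)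
open import Relation.Binary.Construct.Closure.ReflexiveTransitive as Star using (ε; _◅_; _◅◅_)
open import Relation.Binary.Construct.Closure.Symmetric using (fwd; bwd)
open import Relation.Binary.PropositionalEquality as ≡ using (_≡_; _≢_; cong; subst)
open import Relation.Nullary.Decidable using (Dec; yes; no; does; dec-true; dec-false; _×-dec_)
open import Relation.Nullary.Negation using (¬_; contradiction)

private
  variable
    a : Level
    A B P Q : Set a
    n N ℓ : ℕ

-- Adding and removing one element of a finite set

x∉p-x : ∀ {x} {p : Subset n} → x ∉ p ∖ x
x∉p-x {x = zero}  {_ ∷ p} ()
x∉p-x {x = suc x} {s ∷ p} (there x∈) = x∉p-x x∈

p-x⊆p : ∀ {x} (p : Subset n) → p ∖ x ⊆ p
p-x⊆p {x = x} p = p─q⊆p p ⁅ x ⁆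

∣p∪x∣ : ∀ {x} {p : Subset n} → x ∉ p → ∣ p ∪ ⁅ x ⁆ ∣ ≡ suc ∣ p ∣
∣p∪x∣ {x = zero}  {inside  ∷ p} x∉p = contradiction here x∉p
∣p∪x∣ {x = zero}  {outside ∷ p} x∉p = cong (suc ∘ ∣_∣) (∪-identityʳ p)
∣p∪x∣ {x = suc x} {inside  ∷ p} x∉p = cong suc (∣p∪x∣ (x∉p ∘ there))
∣p∪x∣ {x = suc x} {outside ∷ p} x∉p = ∣p∪x∣ (x∉p ∘ there)

x∈p⇒p-x∪x≡p : ∀ {x} {p : Subset n} → x ∈ p → (p ∖ x) ∪ ⁅ x ⁆ ≡ p
x∈p⇒p-x∪x≡p {x = x} {p} x∈p = ⊆-antisym
  (λ y∈ → [ p-x⊆p p , (λ y∈x → subst (_∈ p) (≡.sym (x∈⁅y⁆⇒x≡y x y∈x)) x∈p) ]′ (x∈p∪q⁻ _ _ y∈))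
  (λ {y} y∈p → case y ≟ x of λ where
    (yes ≡.refl) → q⊆p∪q _ _ (x∈⁅x⁆ x)
    (no  y≢x)    → p⊆p∪q _ (x∈p∧x≢y⇒x∈p-y y∈p y≢x))

∣p∣≡suc∣p-x∣ : ∀ {x} {p : Subset n} → x ∈ p → ∣ p ∣ ≡ suc ∣ p ∖ x ∣
∣p∣≡suc∣p-x∣ {x = x} {p} x∈p = ≡.trans (cong ∣_∣ (≡.sym (x∈p⇒p-x∪x≡p x∈p))) (∣p∪x∣ (x∉p-x {x = x} {p}))

p∩[q-x]≡p∩q-x : ∀ (p q : Subset n) x → p ∩ (q ∖ x) ≡ (p ∩ q) ∖ x
p∩[q-x]≡p∩q-x p q x = ⊆-antisym
  (λ y∈ → let y∈p , y∈q-x = x∈p∩q⁻ p (q ∖ x) y∈ in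
    x∈p∧x≢y⇒x∈p-y (x∈p∩q⁺ (y∈p , p-x⊆p q y∈q-x)) (λ { ≡.refl → x∉p-x y∈q-x }))
  (λ y∈ → let y∈p , y∈q = x∈p∩q⁻ p q (p-x⊆p (p ∩ q) y∈) in
    x∈p∩q⁺ (y∈p , x∈p∧x≢y⇒x∈p-y y∈q (λ { ≡.refl → x∉p-x y∈ })))

∪⁅⁆⊆ : ∀ {x} {p q : Subset n} → p ⊆ q → x ∈ q → p ∪ ⁅ x ⁆ ⊆ q
∪⁅⁆⊆ {x = x} p⊆q x∈q y∈ with x∈p∪q⁻ _ _ y∈
... | inj₁ y∈p = p⊆q y∈p
... | inj₂ y∈x with x∈⁅y⁆⇒x≡y x y∈x
...   | ≡.refl = x∈q

nonempty⇒∣p∣≡suc : {p : Subset n} → Nonempty p → ∃ λ s → ∣ p ∣ ≡ suc s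
nonempty⇒∣p∣≡suc (_ , x∈p) = _ , ∣p∣≡suc∣p-x∣ x∈p

-- The set of distinct entries of a list

support : List (Fin n) → Subset n
support []       = ⊥
support (x ∷ xs) = support xs ∪ ⁅ x ⁆

∈-support⁺ : ∀ {x} {xs : List (Fin n)} → x List∈.∈ xs → x ∈ support xs
∈-support⁺ {x = x} (here ≡.refl) = q⊆p∪q _ _ (x∈⁅x⁆ x)
∈-support⁺ (there x∈xs)  = p⊆p∪q _ (∈-support⁺ x∈xs)

∈-support⁻ : ∀ {x} (xs : List (Fin n)) → x ∈ support xs → x List∈.∈ xs
∈-support⁻ []       x∈ = contradiction x∈ ∉⊥
∈-support⁻ (y ∷ xs) x∈ with x∈p∪q⁻ (support xs) _ x∈
... | inj₁ x∈xs = there (∈-support⁻ xs x∈xs)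
... | inj₂ x∈y  = here (x∈⁅y⁆⇒x≡y y x∈y)

∣support∣≤length : (xs : List (Fin n)) → ∣ support xs ∣ ≤ length xs
∣support∣≤length {n} []     = ℕ.≤-reflexive (∣⊥∣≡0 n)
∣support∣≤length (x ∷ xs) with x ∈? support xs
... | no  x∉ = ℕ.≤-trans (ℕ.≤-reflexive (∣p∪x∣ x∉)) (s≤s (∣support∣≤length xs))
... | yes x∈ = ℕ.≤-trans (p⊆q⇒∣p∣≤∣q∣ (∪⁅⁆⊆ id x∈)) (ℕ.m≤n⇒m≤1+n (∣support∣≤length xs))

unique⇒∣support∣≡length : {xs : List (Fin n)} → Unique xs → ∣ support xs ∣ ≡ length xs
unique⇒∣support∣≡length {n}             AllPairs.[]        = ∣⊥∣≡0 n
unique⇒∣support∣≡length {xs = x ∷ xs} (x∉ AllPairs.∷ uniq) = ≡.trans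
  (∣p∪x∣ (λ x∈ → All.lookup x∉ (∈-support⁻ xs x∈) ≡.refl)) (cong suc (unique⇒∣support∣≡length uniq))

-- An entry that recurs adds nothing to the support of its tail, which then falls short of the
-- length. With the converse above, simplicity of a path becomes a numerical condition on the size
-- of its vertex set.
∣support∣≡length⇒unique : (xs : List (Fin n)) → ∣ support xs ∣ ≡ length xs → Unique xs
∣support∣≡length⇒unique []       _ = AllPairs.[]
∣support∣≡length⇒unique (x ∷ xs) eq with x ∈? support xs
... | yes x∈ = contradiction
  (ℕ.≤-trans (ℕ.≤-reflexive (≡.sym eq))
    (ℕ.≤-trans (p⊆q⇒∣p∣≤∣q∣ (∪⁅⁆⊆ id x∈)) (∣support∣≤length xs)))
  ℕ.1+n≰n
... | no  x∉ =
  All.tabulate (λ y∈ x≡y → x∉ (∈-support⁺ (subst (List∈._∈ xs) (≡.sym x≡y) y∈)))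
  AllPairs.∷ ∣support∣≡length⇒unique xs (ℕ.suc-injective (≡.trans (≡.sym (∣p∪x∣ x∉)) eq))

does-true⁻ : (d : Dec P) → does d ≡ true → P
does-true⁻ (yes p) _ = p

-- Weak neighbourhoods, weak connectivity and vertex sets of paths

module _ (G : Digraph N) where
  open Digraph G

  ∈-neighbourhood⁺ : ∀ {C i} → IsNeighbour G C i → i ∈ neighbourhood G C
  ∈-neighbourhood⁺ {C} {i} nb = lookup⇒[]= i _
    (≡.trans (lookup∘tabulate _ i) (dec-true (isNeighbour? G C i) nb))

  ∈-neighbourhood⁻ : ∀ {C i} → i ∈ neighbourhood G C → IsNeighbour G C i
  ∈-neighbourhood⁻ {C} {i} i∈ =
    does-true⁻ (isNeighbour? G C i) (≡.trans (≡.sym (lookup∘tabulate _ i)) ([]=⇒lookup i∈))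

  infix 4 _⊢_⇿_
  _⊢_⇿_ : Subset N → Fin N → Fin N → Set
  C ⊢ i ⇿ j = EqClosure (Induced G C) i j

  ⇿-mono : ∀ {C D} → C ⊆ D → ∀ {i j} → C ⊢ i ⇿ j → D ⊢ i ⇿ j
  ⇿-mono C⊆D = Star.map λ where
    (fwd (i∈ , j∈ , e)) → fwd (C⊆D i∈ , C⊆D j∈ , e)
    (bwd (i∈ , j∈ , e)) → bwd (C⊆D i∈ , C⊆D j∈ , e)

  -- One base point suffices because the generated relation is an equivalence: go back to `i`, then
  -- out again.
  connected-from : ∀ {C i} → (∀ {j} → j ∈ C → C ⊢ i ⇿ j) → WeaklyConnected G C
  connected-from reach j k j∈ k∈ = symmetric (Induced G _) (reach j∈) ◅◅ reach k∈

  connected-∪ : ∀ {S v} → WeaklyConnected G S → IsNeighbour G S v → WeaklyConnected G (S ∪ ⁅ v ⁆)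
  connected-∪ {S} {v} conn (v∉S , u , u∈S , arc) = connected-from reach
    where
    S⊆ : S ⊆ S ∪ ⁅ v ⁆
    S⊆ = p⊆p∪q _
    v∈ : v ∈ S ∪ ⁅ v ⁆
    v∈ = q⊆p∪q S _ (x∈⁅x⁆ v)
    step : E v u ⊎ E u v → S ∪ ⁅ v ⁆ ⊢ u ⇿ v
    step (inj₁ e) = bwd (v∈ , S⊆ u∈S , e) ◅ ε
    step (inj₂ e) = fwd (S⊆ u∈S , v∈ , e) ◅ ε
    reach : ∀ {j} → j ∈ S ∪ ⁅ v ⁆ → S ∪ ⁅ v ⁆ ⊢ u ⇿ j
    reach j∈ with x∈p∪q⁻ _ _ j∈
    ... | inj₁ j∈S = ⇿-mono S⊆ (conn _ _ u∈S j∈S)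
    ... | inj₂ j∈v with x∈⁅y⁆⇒x≡y v j∈v
    ...   | ≡.refl = step arc

  start∈support : ∀ {i j} (p : Path G ℓ i j) → i ∈ support (vertices G p)
  start∈support p@[]      = ∈-support⁺ {xs = vertices G p} (here ≡.refl)
  start∈support p@(_ ∷ _) = ∈-support⁺ {xs = vertices G p} (here ≡.refl)

  singleton-connected : ∀ i → WeaklyConnected G ⁅ i ⁆
  singleton-connected i = connected-from (λ j∈ → subst (⁅ i ⁆ ⊢ i ⇿_) (≡.sym (x∈⁅y⁆⇒x≡y i j∈)) ε)

  connected-support : ∀ {i j} (p : Path G ℓ i j) → WeaklyConnected G (support (vertices G p))
  connected-support p = connected-from (λ j∈ → reach p id (∈-support⁻ _ j∈))
    where
    -- The ambient set `C` stays fixed while the path is consumed, so the walk along a tail still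
    -- lies in the support of the original path.
    reach : ∀ {ℓ i j C} (p : Path G ℓ i j) → support (vertices G p) ⊆ C →
            ∀ {x} → x List∈.∈ vertices G p → C ⊢ i ⇿ x
    reach []      ⊆C (here ≡.refl) = ε
    reach (e ∷ p) ⊆C (here ≡.refl) = ε
    reach (e ∷ p) ⊆C (there x∈)    =
      fwd (⊆C (start∈support (e ∷ p)) , ⊆C (p⊆p∪q _ (start∈support p)) , e) ◅ reach p (⊆C ∘ p⊆p∪q _) x∈

  -- A walk inside `C` that starts in `S` can leave `S` only by stepping to a vertex of `C` adjacent
  -- to `S`, and there is none.
  connected-closed : ∀ {S C i} → i ∈ S → S ⊆ C → WeaklyConnected G C →
                     (∀ {v} → v ∈ C → ¬ IsNeighbour G S v) → C ⊆ S
  connected-closed {S} {C} i∈S S⊆C conn boundary {j} j∈C = walk i∈S (conn _ _ (S⊆C i∈S) j∈C)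
    where
    into : ∀ {x y} → x ∈ S → y ∈ C → E x y ⊎ E y x → y ∈ S
    into {x} {y} x∈S y∈C arc with y ∈? S
    ... | yes y∈S = y∈S
    ... | no  y∉S = contradiction (y∉S , x , x∈S , [ inj₂ , inj₁ ]′ arc) (boundary y∈C)
    walk : ∀ {x y} → x ∈ S → C ⊢ x ⇿ y → y ∈ S
    walk x∈S ε = x∈S
    walk x∈S (fwd (_ , y∈C , e) ◅ w) = walk (into x∈S y∈C (inj₁ e)) w
    walk x∈S (bwd (y∈C , _ , e) ◅ w) = walk (into x∈S y∈C (inj₂ e)) w

  length-vertices : ∀ {i j} (p : Path G ℓ i j) → length (vertices G p) ≡ suc ℓ
  length-vertices []      = ≡.refl
  length-vertices (_ ∷ p) = cong suc (length-vertices p)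

  length-sources : ∀ {i j} (p : Path G ℓ i j) → length (sources G p) ≡ ℓ
  length-sources []      = ≡.refl
  length-sources (_ ∷ p) = cong suc (length-sources p)

  -- The end vertex is also the start vertex, which is already a source because the length is
  -- positive. Hence the vertex set of a cycle can be counted on its sources.
  support-closed : ∀ {i} (p : Path G (suc ℓ) i i) → support (vertices G p) ≡ support (sources G p)
  support-closed {i = i} q@(e ∷ p) = ⊆-antisym
    (λ x∈ → [ ∈-support⁺ , (λ { (here ≡.refl) → ∈-support⁺ {xs = sources G q} (here ≡.refl) }) ]′
              (∈-++⁻ (sources G q) (∈-support⁻ (vertices G q) x∈)))
    (λ x∈ → ∈-support⁺ (∈-++⁺ˡ (∈-support⁻ (sources G q) x∈)))

-- Entries of identity, diagonal and restricted matrices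

module _ {c r : Level} (S : RawRing c r) where
  open RawRing S

  identity-diagonal : (i : Fin n) → identity S i i ≡ 1#
  identity-diagonal i with i ≟ i
  ... | yes _  = ≡.refl
  ... | no i≢i = contradiction ≡.refl i≢i

  identity-off-diagonal : ∀ {i j : Fin n} → i ≢ j → identity S i j ≡ 0#
  identity-off-diagonal {i = i} {j} i≢j with i ≟ j
  ... | yes i≡j = contradiction i≡j i≢j
  ... | no _    = ≡.refl

  Diag-diagonal : (M : Matrix S n) → ∀ i → Diag S M i i ≡ M i i
  Diag-diagonal M i with i ≟ i
  ... | yes _  = ≡.refl
  ... | no i≢i = contradiction ≡.refl i≢i

  Diag-off-diagonal : (M : Matrix S n) → ∀ {i j} → i ≢ j → Diag S M i j ≡ 0#
  Diag-off-diagonal M {i} {j} i≢j with i ≟ j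
  ... | yes i≡j = contradiction i≡j i≢j
  ... | no _    = ≡.refl

  restrict-in : ∀ {C i j} (M : Matrix S n) → i ∈ C → j ∈ C → restrict S C M i j ≡ M i j
  restrict-in {C = C} {i} {j} M i∈C j∈C with (i ∈? C) ×-dec (j ∈? C)
  ... | yes _   = ≡.refl
  ... | no ¬ij∈ = contradiction (i∈C , j∈C) ¬ij∈

  restrict-out : ∀ {C i j} (M : Matrix S n) → ¬ (i ∈ C × j ∈ C) → restrict S C M i j ≡ 0#
  restrict-out {C = C} {i} {j} M ¬ij∈ with (i ∈? C) ×-dec (j ∈? C)
  ... | yes ij∈ = contradiction ij∈ ¬ij∈
  ... | no _    = ≡.refl

-- Finite sums and indicators in a ring

module _ {c r : Level} (R : Ring c r) where
  open Ring R hiding (zero; _-_)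
  open RingProperties R using (-‿distribˡ-*; -‿distribʳ-*; -‿+-comm; -0#≈0#)
  open SumProperties semiring
  open MultProperties semiring using (×-congʳ; ×-idem; ×-assoc-*) renaming (_×_ to _·_)
  open CommutativeSemigroupProperties +-commutativeSemigroup using (interchange)
  open import Relation.Binary.Reasoning.Setoid setoid

  sum-single : ∀ {n} (i : Fin n) (f : Fin n → Carrier) → (∀ k → k ≢ i → f k ≈ 0#) → sum f ≈ f i
  sum-single {suc n} zero f vanish = begin
    f zero + sum (f ∘ suc)    ≈⟨ +-congˡ (sum-cong-≋ (λ k → vanish (suc k) (λ ()))) ⟩
    f zero + sum {n} (λ _ → 0#) ≈⟨ +-congˡ (sum-replicate-zero n) ⟩
    f zero + 0#               ≈⟨ +-identityʳ _ ⟩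
    f zero                    ∎
  sum-single (suc i) f vanish = begin
    f zero + sum (f ∘ suc)    ≈⟨ +-cong (vanish zero (λ ())) (sum-single i (f ∘ suc) vanish′) ⟩
    0# + f (suc i)            ≈⟨ +-identityˡ _ ⟩
    f (suc i)                 ∎
    where
    vanish′ : ∀ k → k ≢ i → f (suc k) ≈ 0#
    vanish′ k k≢i = vanish (suc k) (λ { ≡.refl → k≢i ≡.refl })

  -- Built from the same `foldr` and `map` as the entries of `P`, so that these are instances of it
  -- by computation.
  ⅀ : List A → (A → Carrier) → Carrier
  ⅀ xs f = foldr _+_ 0# (map f xs)

  ⅀-cong : (xs : List A) {f g : A → Carrier} → (∀ {x} → x List∈.∈ xs → f x ≈ g x) → ⅀ xs f ≈ ⅀ xs g
  ⅀-cong []       f≈g = refl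
  ⅀-cong (x ∷ xs) f≈g = +-cong (f≈g (here ≡.refl)) (⅀-cong xs (f≈g ∘ there))

  ⅀-zero : (xs : List A) → ⅀ xs (λ _ → 0#) ≈ 0#
  ⅀-zero []       = refl
  ⅀-zero (x ∷ xs) = trans (+-identityˡ _) (⅀-zero xs)

  ⅀-++ : (xs ys : List A) (f : A → Carrier) → ⅀ (xs ++ ys) f ≈ ⅀ xs f + ⅀ ys f
  ⅀-++ []       ys f = sym (+-identityˡ _)
  ⅀-++ (x ∷ xs) ys f = trans (+-congˡ (⅀-++ xs ys f)) (sym (+-assoc _ _ _))

  ⅀-+ : (xs : List A) (f g : A → Carrier) → ⅀ xs (λ x → f x + g x) ≈ ⅀ xs f + ⅀ xs g
  ⅀-+ []       f g = sym (+-identityˡ _)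
  ⅀-+ (x ∷ xs) f g = trans (+-congˡ (⅀-+ xs f g)) (interchange _ _ _ _)

  ⅀-comm : (xs : List A) (ys : List B) (f : A → B → Carrier) →
           ⅀ xs (λ x → ⅀ ys (f x)) ≈ ⅀ ys (λ y → ⅀ xs (λ x → f x y))
  ⅀-comm []       ys f = sym (⅀-zero ys)
  ⅀-comm (x ∷ xs) ys f = trans (+-congˡ (⅀-comm xs ys f)) (sym (⅀-+ ys (f x) _))

  *-distribˡ-⅀ : ∀ x (ys : List A) (f : A → Carrier) → x * ⅀ ys f ≈ ⅀ ys (λ y → x * f y)
  *-distribˡ-⅀ x []       f = zeroʳ x
  *-distribˡ-⅀ x (y ∷ ys) f = trans (distribˡ _ _ _) (+-congˡ (*-distribˡ-⅀ x ys f))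

  *-distribʳ-⅀ : ∀ x (ys : List A) (f : A → Carrier) → ⅀ ys f * x ≈ ⅀ ys (λ y → f y * x)
  *-distribʳ-⅀ x []       f = zeroˡ x
  *-distribʳ-⅀ x (y ∷ ys) f = trans (distribʳ _ _ _) (+-congˡ (*-distribʳ-⅀ x ys f))

  sum-⅀-comm : ∀ {n} (ys : List B) (f : Fin n → B → Carrier) →
               sum (λ i → ⅀ ys (f i)) ≈ ⅀ ys (λ y → sum (λ i → f i y))
  sum-⅀-comm {n = zero}  ys f = sym (⅀-zero ys)
  sum-⅀-comm {n = suc n} ys f = trans (+-congˡ (sum-⅀-comm ys (f ∘ suc))) (sym (⅀-+ ys (f zero) _))

  ⅀-concatMap-tabulate : ∀ {n} (f : A → List B) (h : Fin n → A) (g : B → Carrier) →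
                         ⅀ (concatMap f (tabulate h)) g ≈ sum (λ k → ⅀ (f (h k)) g)
  ⅀-concatMap-tabulate {n = zero}  f h g = refl
  ⅀-concatMap-tabulate {n = suc n} f h g = trans (⅀-++ (f (h zero)) _ g)
    (+-congˡ (⅀-concatMap-tabulate f (h ∘ suc) g))

  -- The Iverson bracket. It branches on `does d`, so only the truth value of the decision matters
  -- and not the proof that it carries.
  when : Dec P → Carrier → Carrier
  when d x = if does d then x else 0#

  when-yes : (d : Dec P) → P → ∀ {x} → when d x ≈ x
  when-yes d p rewrite dec-true d p = refl

  when-no : (d : Dec P) → ¬ P → ∀ {x} → when d x ≈ 0#
  when-no d ¬p rewrite dec-false d ¬p = refl

  when-cong : (d : Dec P) (e : Dec Q) → (P → Q) → (Q → P) → ∀ {x y} → (P → x ≈ y) → when d x ≈ when e y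
  when-cong (yes p) e to from x≈y = trans (x≈y p) (sym (when-yes e (to p)))
  when-cong (no ¬p) e to from x≈y = sym (when-no e (¬p ∘ from))

  when-* : (d : Dec P) → ∀ x y → when d x * y ≈ when d (x * y)
  when-* (yes _) x y = refl
  when-* (no _)  x y = zeroˡ y

  *-when : (d : Dec P) → ∀ x y → x * when d y ≈ when d (x * y)
  *-when (yes _) x y = refl
  *-when (no _)  x y = zeroʳ x

  ⅀-filter : ∀ {P : A → Set} (P? : ∀ x → Dec (P x)) (xs : List A) (f : A → Carrier) →
             ⅀ (filter P? xs) f ≈ ⅀ xs (λ x → when (P? x) (f x))
  ⅀-filter P? []       f = refl
  ⅀-filter P? (x ∷ xs) f with does (P? x)
  ... | true  = +-congˡ (⅀-filter P? xs f)
  ... | false = trans (⅀-filter P? xs f) (sym (+-identityˡ _))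

  -- A Kronecker delta; absence of repetitions in the list ensures that the value is picked up once
  -- only.
  ⅀-single : (_≟ᴬ_ : ∀ x y → Dec (x ≡ y)) {s : A} {xs : List A} → Unique xs → s List∈.∈ xs →
             ∀ x → ⅀ xs (λ y → when (y ≟ᴬ s) x) ≈ x
  ⅀-single _≟ᴬ_ {s} {_ ∷ xs} (s∉ AllPairs.∷ _) (here ≡.refl) x = begin
    when (s ≟ᴬ s) x + ⅀ xs (λ y → when (y ≟ᴬ s) x)
      ≈⟨ +-cong (when-yes (s ≟ᴬ s) ≡.refl)
           (⅀-cong xs (λ y∈ → when-no (_ ≟ᴬ s) (λ y≡s → All.lookup s∉ y∈ (≡.sym y≡s)))) ⟩
    x + ⅀ xs (λ _ → 0#)  ≈⟨ +-congˡ (⅀-zero xs) ⟩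
    x + 0#               ≈⟨ +-identityʳ x ⟩
    x                    ∎
  ⅀-single _≟ᴬ_ {s} {z ∷ xs} (z∉ AllPairs.∷ uniq) (there s∈) x = begin
    when (z ≟ᴬ s) x + ⅀ xs (λ y → when (y ≟ᴬ s) x)
      ≈⟨ +-cong (when-no (z ≟ᴬ s) (All.lookup z∉ s∈)) (⅀-single _≟ᴬ_ uniq s∈ x) ⟩
    0# + x  ≈⟨ +-identityˡ x ⟩
    x       ∎

  sum-∈ : (C : Subset n) → ∀ x → sum (λ i → when (i ∈? C) x) ≈ ∣ C ∣ · x
  sum-∈ []            x = refl
  sum-∈ (inside  ∷ C) x = +-congˡ (sum-∈ C x)
  sum-∈ (outside ∷ C) x = trans (+-identityˡ _) (sum-∈ C x)

  -- The scalar series z^a (1 - z)^b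

  x≈y+[x-y] : ∀ x y → x ≈ y + (x + - y)
  x≈y+[x-y] x y = begin
    x                ≈⟨ +-identityˡ x ⟨
    0# + x           ≈⟨ +-congʳ (-‿inverseʳ y) ⟨
    (y + - y) + x    ≈⟨ +-assoc _ _ _ ⟩
    y + (- y + x)    ≈⟨ +-congˡ (+-comm _ _) ⟩
    y + (x + - y)    ∎

  -- The recurrence satisfied by t a b = x^a (1 - x)^b.
  Exploratory : (ℕ → ℕ → Carrier) → Set r
  Exploratory t = ∀ a b → t a b ≈ t (suc a) b + t a (suc b)

  -- shift a u is the series z^a u.
  shift : ℕ → Series rawRing → Series rawRing
  shift zero    u k       = u k
  shift (suc a) u zero    = 0#
  shift (suc a) u (suc k) = shift a u k

  open RawRing (powerSeries rawRing) using () renaming (_*_ to _⋆_; 1# to one)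

  -- Defined by a recursion on coefficients, free of binomials and convolutions. That this is the
  -- power of 1 - z for the product of series rests on `[1-z]⋆`.
  [1-z]^ : ℕ → Series rawRing
  [1-z]^ zero      = one
  [1-z]^ (suc b) k = [1-z]^ b k + - shift 1 ([1-z]^ b) k

  -- Coefficientwise, z^a (1 - z)^b = z^(a+1) (1 - z)^b + z^a (1 - z)^(b+1). For a = 0 this is the
  -- defining recursion of `[1-z]^`; each further factor z only lowers the index.
  shift-exploratory : ∀ k → Exploratory (λ a b → shift a ([1-z]^ b) k)
  shift-exploratory k       zero    b = x≈y+[x-y] _ _
  shift-exploratory zero    (suc a) b = sym (+-identityˡ 0#)
  shift-exploratory (suc k) (suc a) b = shift-exploratory k a b

  shift-one-≡ : ∀ a → shift a one a ≈ 1#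
  shift-one-≡ zero    = refl
  shift-one-≡ (suc a) = shift-one-≡ a

  shift-one-≢ : ∀ {a k} → a ≢ k → shift a one k ≈ 0#
  shift-one-≢ {zero}  {zero}  a≢k = contradiction ≡.refl a≢k
  shift-one-≢ {zero}  {suc k} a≢k = refl
  shift-one-≢ {suc a} {zero}  a≢k = refl
  shift-one-≢ {suc a} {suc k} a≢k = shift-one-≢ (a≢k ∘ cong suc)

  -- Induction on `a`: the leading coefficient is zero, and what remains of the convolution is by
  -- computation the one for `a` and `k`.
  shift-⋆ : ∀ a u k → (shift a one ⋆ u) k ≈ shift a u k
  shift-⋆ zero    u zero    = trans (+-identityʳ _) (*-identityˡ _)
  shift-⋆ zero    u (suc k) = begin
    1# * u (suc k) + sum {suc k} (λ i → 0# * u (k ∸ toℕ i))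
      ≈⟨ +-cong (*-identityˡ _) (sum-cong-≋ {suc k} (λ i → zeroˡ (u (k ∸ toℕ i)))) ⟩
    u (suc k) + sum {suc k} (λ _ → 0#)
      ≈⟨ +-congˡ (sum-replicate-zero (suc k)) ⟩
    u (suc k) + 0#
      ≈⟨ +-identityʳ _ ⟩
    u (suc k) ∎
  shift-⋆ (suc a) u zero    = trans (+-identityʳ _) (zeroˡ _)
  shift-⋆ (suc a) u (suc k) = trans (+-cong (zeroˡ _) (shift-⋆ a u k)) (+-identityˡ _)

  sum-neg : ∀ {n} (f : Fin n → Carrier) → sum (λ i → - f i) ≈ - sum f
  sum-neg {zero}  f = sym -0#≈0#
  sum-neg {suc n} f = trans (+-congˡ (sum-neg (f ∘ suc))) (-‿+-comm _ _)

  [1-z]⋆ : ∀ u k → ([1-z]^ 1 ⋆ u) k ≈ u k + - shift 1 u k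
  [1-z]⋆ u k = begin
    sum {suc k} (λ i → (one (toℕ i) + - shift 1 one (toℕ i)) * u (k ∸ toℕ i))
      ≈⟨ sum-cong-≋ {suc k} (λ i → trans (distribʳ (u (k ∸ toℕ i)) (one (toℕ i)) (- shift 1 one (toℕ i)))
           (+-congˡ (sym (-‿distribˡ-* (shift 1 one (toℕ i)) (u (k ∸ toℕ i)))))) ⟩
    sum {suc k} (λ i → f i + - g i)
      ≈⟨ ∑-distrib-+ {suc k} f (λ i → - g i) ⟩
    sum f + sum (λ i → - g i)
      ≈⟨ +-cong (shift-⋆ 0 u k) (trans (sum-neg g) (-‿cong (shift-⋆ 1 u k))) ⟩
    u k + - shift 1 u k ∎
    where
    f g : Fin (suc k) → Carrier
    f i = one (toℕ i) * u (k ∸ toℕ i)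
    g i = shift 1 one (toℕ i) * u (k ∸ toℕ i)

  -- Labels need not commute, but the scalar series have central coefficients. This lets a
  -- coefficient of the second factor of a product move past a matrix entry of the first.
  Central : Series rawRing → Set _
  Central u = ∀ k x → u k * x ≈ x * u k

  central-one : Central one
  central-one zero    x = trans (*-identityˡ x) (sym (*-identityʳ x))
  central-one (suc k) x = trans (zeroˡ x) (sym (zeroʳ x))

  central-shift : ∀ a {u} → Central u → Central (shift a u)
  central-shift zero    cu k       x = cu k x
  central-shift (suc a) cu zero    x = trans (zeroˡ x) (sym (zeroʳ x))
  central-shift (suc a) cu (suc k) x = central-shift a cu k x

  central-[1-z]^ : ∀ b → Central ([1-z]^ b)
  central-[1-z]^ zero    k x = central-one k x
  central-[1-z]^ (suc b) k x = begin
    (u + - v) * x      ≈⟨ distribʳ _ _ _ ⟩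
    u * x + - v * x    ≈⟨ +-congˡ (-‿distribˡ-* v x) ⟨
    u * x + - (v * x)  ≈⟨ +-cong (central-[1-z]^ b k x)
                            (-‿cong (central-shift 1 (central-[1-z]^ b) k x)) ⟩
    x * u + - (x * v)  ≈⟨ +-congˡ (-‿distribʳ-* x v) ⟩
    x * u + x * - v    ≈⟨ distribˡ _ _ _ ⟨
    x * (u + - v)      ∎
    where
    u = [1-z]^ b k
    v = shift 1 ([1-z]^ b) k

  -- Evaluating scalar series at z M

  sum-coefficient : ∀ {n} (f : Fin n → Series rawRing) k →
    RawSemiringDefs.sum (RawRing.rawSemiring (powerSeries rawRing)) f k ≡ sum (λ i → f i k)
  sum-coefficient {zero}  f k = ≡.refl
  sum-coefficient {suc n} f k = cong (f zero k +_) (sum-coefficient (f ∘ suc) k)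

  identityˡ : ∀ {n} (i : Fin n) (f : Fin n → Carrier) → sum (λ k → identity rawRing i k * f k) ≈ f i
  identityˡ i f = trans
    (sum-single i _ (λ k k≢i → trans (*-congʳ (reflexive (identity-off-diagonal rawRing (k≢i ∘ ≡.sym)))) (zeroˡ _)))
    (trans (*-congʳ (reflexive (identity-diagonal rawRing i))) (*-identityˡ _))

  identityʳ : ∀ {n} (j : Fin n) (f : Fin n → Carrier) → sum (λ k → f k * identity rawRing k j) ≈ f j
  identityʳ j f = trans
    (sum-single j _ (λ k k≢j → trans (*-congˡ (reflexive (identity-off-diagonal rawRing k≢j))) (zeroʳ _)))
    (trans (*-congˡ (reflexive (identity-diagonal rawRing j))) (*-identityʳ _))

  one-*-identity : ∀ (i j : Fin n) k → identity (powerSeries rawRing) i j k ≈ one k * identity rawRing i j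
  one-*-identity i j k = case i ≟ j of λ where
      (yes ≡.refl) → trans (reflexive (≡.cong-app (identity-diagonal (powerSeries rawRing) i) k))
        (sym (trans (*-congˡ (reflexive (identity-diagonal rawRing i))) (*-identityʳ _)))
      (no i≢j)     → trans (reflexive (≡.cong-app (identity-off-diagonal (powerSeries rawRing) i≢j) k))
        (sym (trans (*-congˡ (reflexive (identity-off-diagonal rawRing i≢j))) (zeroʳ _)))

  module _ {N : ℕ} (M : Matrix rawRing N) where

    private
      𝕄 = matrices rawRing N
      𝕊 = matrices (powerSeries rawRing) N
      module 𝕄 = RawSemiringDefs (RawRing.rawSemiring 𝕄)
      open RawRing 𝕊 using ()
        renaming (_*_ to _⊛_; 1# to I; -_ to ⊖_; _+_ to _⊕_; Carrier to SeriesMatrix)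
      open RawSemiringDefs (RawRing.rawSemiring 𝕊) using () renaming (_^_ to _⊛^_)

    -- Matrices form only a raw ring here, so the associativity behind the power law is obtained in
    -- place by exchanging the two sums.
    ^-+ : ∀ a b i j → sum (λ k → (M 𝕄.^ a) i k * (M 𝕄.^ b) k j) ≈ (M 𝕄.^ (a ℕ.+ b)) i j
    ^-+ zero    b i j = identityˡ i _
    ^-+ (suc a) b i j = begin
      sum (λ k → sum (λ l → M i l * X l k) * Y k)
        ≈⟨ sum-cong-≋ {N} (λ k → trans (*-distribʳ-sum {N} (Y k) (λ l → M i l * X l k))
             (sum-cong-≋ {N} (λ l → *-assoc (M i l) (X l k) (Y k)))) ⟩
      sum (λ k → sum (λ l → M i l * (X l k * Y k)))
        ≈⟨ ∑-comm (λ k l → M i l * (X l k * Y k)) ⟩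
      sum (λ l → sum (λ k → M i l * (X l k * Y k)))
        ≈⟨ sum-cong-≋ {N} (λ l → trans (sym (*-distribˡ-sum {N} (M i l) (λ k → X l k * Y k)))
             (*-congˡ (^-+ a b l j))) ⟩
      sum (λ l → M i l * (M 𝕄.^ (a ℕ.+ b)) l j) ∎
      where
      X = M 𝕄.^ a
      Y = λ k → (M 𝕄.^ b) k j

    -- A is the series u evaluated at z M.
    _IsEvaluationOf_ : SeriesMatrix → Series rawRing → Set r
    A IsEvaluationOf u = ∀ i j k → A i j k ≈ u k * (M 𝕄.^ k) i j

    zM : SeriesMatrix
    zM i j = z⟨_⟩ rawRing (M i j)

    eval-resp : ∀ {A u v} → (∀ k → u k ≈ v k) → A IsEvaluationOf u → A IsEvaluationOf v
    eval-resp u≈v eA i j k = trans (eA i j k) (*-congʳ (u≈v k))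

    -- In degree k the product collects the terms u_m M^m v_(k-m) M^(k-m). Centrality brings the
    -- scalars together, and the matrix factor M^k no longer depends on m.
    eval-⊛ : ∀ {A B u v} → A IsEvaluationOf u → B IsEvaluationOf v → Central v →
             (A ⊛ B) IsEvaluationOf (u ⋆ v)
    eval-⊛ {A} {B} {u} {v} eA eB cv i j k = begin
      (A ⊛ B) i j k
        ≡⟨ sum-coefficient (λ l → A i l ⋆ B l j) k ⟩
      sum (λ l → sum {suc k} (λ m → A i l (toℕ m) * B l j (k ∸ toℕ m)))
        ≈⟨ sum-cong-≋ {N} (λ l → sum-cong-≋ {suc k} (λ m →
             trans (*-cong (eA i l (toℕ m)) (eB l j (k ∸ toℕ m))) (swap m l))) ⟩
      sum (λ l → sum (λ m → (x m * y m) * (p m l * q m l)))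
        ≈⟨ ∑-comm (λ l m → (x m * y m) * (p m l * q m l)) ⟩
      sum (λ m → sum (λ l → (x m * y m) * (p m l * q m l)))
        ≈⟨ sum-cong-≋ (λ m → *-distribˡ-sum {N} (x m * y m) (λ l → p m l * q m l)) ⟨
      sum (λ m → (x m * y m) * sum (λ l → p m l * q m l))
        -- Since m is at most k, the truncated subtraction is exact and the exponents add up to k.
        ≈⟨ sum-cong-≋ (λ m → *-congˡ {x m * y m} (trans (^-+ (toℕ m) (k ∸ toℕ m) i j)
             (reflexive (cong (λ e → (M 𝕄.^ e) i j) (ℕ.m+[n∸m]≡n (toℕ≤pred[n] m)))))) ⟩
      sum (λ m → (x m * y m) * (M 𝕄.^ k) i j)
        ≈⟨ *-distribʳ-sum ((M 𝕄.^ k) i j) (λ m → x m * y m) ⟨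
      (u ⋆ v) k * (M 𝕄.^ k) i j ∎
      where
      x y : Fin (suc k) → Carrier
      x m = u (toℕ m)
      y m = v (k ∸ toℕ m)
      p q : Fin (suc k) → Fin N → Carrier
      p m l = (M 𝕄.^ toℕ m) i l
      q m l = (M 𝕄.^ (k ∸ toℕ m)) l j
      swap : ∀ m l → (x m * p m l) * (y m * q m l) ≈ (x m * y m) * (p m l * q m l)
      swap m l = begin
        (x m * p m l) * (y m * q m l)  ≈⟨ *-assoc _ _ _ ⟩
        x m * (p m l * (y m * q m l))  ≈⟨ *-congˡ (*-assoc _ _ _) ⟨
        x m * ((p m l * y m) * q m l)  ≈⟨ *-congˡ (*-congʳ (cv (k ∸ toℕ m) (p m l))) ⟨
        x m * ((y m * p m l) * q m l)  ≈⟨ *-congˡ (*-assoc _ _ _) ⟩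
        x m * (y m * (p m l * q m l))  ≈⟨ *-assoc _ _ _ ⟨
        (x m * y m) * (p m l * q m l)  ∎

    eval-I : I IsEvaluationOf one
    eval-I i j zero    = one-*-identity i j zero
    eval-I i j (suc k) = trans (one-*-identity i j (suc k)) (trans (zeroˡ _) (sym (zeroˡ _)))

    eval-zM : zM IsEvaluationOf shift 1 one
    eval-zM i j 0             = sym (zeroˡ _)
    eval-zM i j 1             = sym (trans (*-identityˡ _) (identityʳ j _))
    eval-zM i j (suc (suc k)) = sym (zeroˡ _)

    eval-I-zM : (I ⊕ (⊖ zM)) IsEvaluationOf [1-z]^ 1
    eval-I-zM i j k = trans
      (+-cong (eval-I i j k) (trans (-‿cong (eval-zM i j k)) (-‿distribˡ-* _ _)))
      (sym (distribʳ _ _ _))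

    eval-zM^ : ∀ a → (zM ⊛^ a) IsEvaluationOf shift a one
    eval-zM^ zero    = eval-I
    eval-zM^ (suc a) = eval-resp shift-suc
      (eval-⊛ {zM} {zM ⊛^ a} eval-zM (eval-zM^ a) (central-shift a central-one))
      where
      shift-suc : ∀ k → (shift 1 one ⋆ shift a one) k ≈ shift (suc a) one k
      shift-suc zero    = shift-⋆ 1 (shift a one) zero
      shift-suc (suc k) = shift-⋆ 1 (shift a one) (suc k)

    eval-[I-zM]^ : ∀ b → ((I ⊕ (⊖ zM)) ⊛^ b) IsEvaluationOf [1-z]^ b
    eval-[I-zM]^ zero    = eval-I
    eval-[I-zM]^ (suc b) = eval-resp ([1-z]⋆ ([1-z]^ b))
      (eval-⊛ {I ⊕ (⊖ zM)} {(I ⊕ (⊖ zM)) ⊛^ b} eval-I-zM (eval-[I-zM]^ b) (central-[1-z]^ b))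

    -- This separates the two roles of C: the scalar depends only on the exponents, while the matrix
    -- power carries the paths.
    eval-product : ∀ a b → ((zM ⊛^ a) ⊛ ((I ⊕ (⊖ zM)) ⊛^ b)) IsEvaluationOf shift a ([1-z]^ b)
    eval-product a b = eval-resp (shift-⋆ a ([1-z]^ b))
      (eval-⊛ {zM ⊛^ a} {(I ⊕ (⊖ zM)) ⊛^ b} (eval-zM^ a) (eval-[I-zM]^ b) (central-[1-z]^ b))

  -- Exploring clusters: the sum over connected vertex sets

  module _ (G : Digraph N) where

    private
      𝒞 = connectedSubsets G

      _≟ˢ_ : (C D : Subset N) → Dec (C ≡ D)
      _≟ˢ_ = ≡-dec Bool._≟_

    ∈𝒞⁻ : ∀ {C} → C List∈.∈ 𝒞 → Nonempty C × WeaklyConnected G C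
    ∈𝒞⁻ C∈ = proj₂ (∈-filter⁻ (λ C → nonempty? C ×-dec weaklyConnected? G C) {xs = subsets N} C∈)

    Between : Subset N → Subset N → Subset N → Set
    Between S U C = S ⊆ C × C ⊆ U

    between? : ∀ S U C → Dec (Between S U C)
    between? S U C = (S ⊆? C) ×-dec (C ⊆? U)

    -- The total weight of the possible clusters of `S` when the vertices outside `U` have already
    -- been found closed. Their factors 1 - x are carried by `t`, so only the neighbours inside `U`
    -- are counted.
    clusterSum : (ℕ → ℕ → Carrier) → Subset N → Subset N → Carrier
    clusterSum t S U = ⅀ 𝒞 λ C → when (between? S U C) (t ∣ C ∣ ∣ neighbourhood G C ∩ U ∣)

    -- Reveal the boundary vertex `v`. If it lies in the cluster, it joins `S`. Otherwise it leaves
    -- `U`, and since it is adjacent to `S` it is a neighbour of every such cluster, whence the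
    -- extra unit in the second argument of `t`.
    explore : ∀ {t} → Exploratory t → ∀ {S U v} → v ∈ U → IsNeighbour G S v →
              clusterSum t S U ≈ clusterSum t (S ∪ ⁅ v ⁆) U + clusterSum (λ a b → t a (suc b)) S (U ∖ v)
    explore {t} rec {S} {U} {v} v∈U (v∉S , u , u∈S , arc) =
      trans (⅀-cong 𝒞 (λ _ → split _)) (⅀-+ 𝒞 _ _)
      where
      split : ∀ C → when (between? S U C) (t ∣ C ∣ ∣ neighbourhood G C ∩ U ∣) ≈
                    when (between? (S ∪ ⁅ v ⁆) U C) (t ∣ C ∣ ∣ neighbourhood G C ∩ U ∣) +
                    when (between? S (U ∖ v) C) (t ∣ C ∣ (suc ∣ neighbourhood G C ∩ (U ∖ v) ∣))
      split C with v ∈? C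
      ... | yes v∈C = trans
        (when-cong (between? S U C) (between? (S ∪ ⁅ v ⁆) U C)
          (λ (S⊆C , C⊆U) → ∪⁅⁆⊆ S⊆C v∈C , C⊆U)
          (λ (S∪v⊆C , C⊆U) → S∪v⊆C ∘ p⊆p∪q _ , C⊆U)
          (λ _ → refl))
        (sym (trans
          (+-congˡ (when-no (between? S (U ∖ v) C) (λ (_ , C⊆U-v) → x∉p-x (C⊆U-v v∈C))))
          (+-identityʳ _)))
      ... | no  v∉C = trans
        (when-cong (between? S U C) (between? S (U ∖ v) C)
          (λ (S⊆C , C⊆U) → S⊆C , λ x∈C → x∈p∧x≢y⇒x∈p-y (C⊆U x∈C) (λ { ≡.refl → v∉C x∈C }))
          (λ (S⊆C , C⊆U-v) → S⊆C , p-x⊆p U ∘ C⊆U-v)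
          (λ (S⊆C , _) → reflexive (cong (t ∣ C ∣) (shrink S⊆C))))
        (sym (trans
          (+-congʳ (when-no (between? (S ∪ ⁅ v ⁆) U C)
            (λ (S∪v⊆C , _) → v∉C (S∪v⊆C (q⊆p∪q S _ (x∈⁅x⁆ v))))))
          (+-identityˡ _)))
        where
        shrink : S ⊆ C → ∣ neighbourhood G C ∩ U ∣ ≡ suc ∣ neighbourhood G C ∩ (U ∖ v) ∣
        shrink S⊆C rewrite p∩[q-x]≡p∩q-x (neighbourhood G C) U v = ∣p∣≡suc∣p-x∣
          (x∈p∩q⁺ (∈-neighbourhood⁺ G (v∉C , u , S⊆C u∈S , arc) , v∈U))

    -- With no neighbour of `S` left in `U`, a connected set between them cannot grow beyond `S`,
    -- and the neighbourhood of `S` misses `U`.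
    clusterSum-blocked : ∀ t {S U} → S ⊆ U → Nonempty S → WeaklyConnected G S →
                         (∀ {v} → v ∈ U → ¬ IsNeighbour G S v) → clusterSum t S U ≈ t ∣ S ∣ 0
    clusterSum-blocked t {S} {U} S⊆U (i , i∈S) conn boundary = begin
      clusterSum t S U
        ≈⟨ ⅀-cong 𝒞 (λ C∈ → only (proj₂ (∈𝒞⁻ C∈))) ⟩
      ⅀ 𝒞 (λ C → when (C ≟ˢ S) (t ∣ S ∣ 0))
        ≈⟨ ⅀-single _≟ˢ_ (Unique.filter⁺ _ (subsets-unique N))
             (∈-filter⁺ _ (∈-subsets S) ((i , i∈S) , conn)) _ ⟩
      t ∣ S ∣ 0 ∎
      where
      empty : ∣ neighbourhood G S ∩ U ∣ ≡ 0
      empty = ≡.trans (cong ∣_∣ (Empty-unique (λ (v , v∈) →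
        let v∈N , v∈U = x∈p∩q⁻ _ U v∈ in boundary v∈U (∈-neighbourhood⁻ G v∈N)))) (∣⊥∣≡0 N)

      C≡S : ∀ {C} → WeaklyConnected G C → Between S U C → C ≡ S
      C≡S connC (S⊆C , C⊆U) = ⊆-antisym (connected-closed G i∈S S⊆C connC (boundary ∘ C⊆U)) S⊆C

      only : ∀ {C} → WeaklyConnected G C →
             when (between? S U C) (t ∣ C ∣ ∣ neighbourhood G C ∩ U ∣) ≈ when (C ≟ˢ S) (t ∣ S ∣ 0)
      only {C} connC = when-cong (between? S U C) (C ≟ˢ S)
        (C≡S connC) (λ { ≡.refl → id , S⊆U }) (λ btw → reflexive
          (≡.trans (cong (λ D → t ∣ D ∣ ∣ neighbourhood G D ∩ U ∣) (C≡S connC btw)) (cong (t ∣ S ∣) empty)))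

    -- Induction on the gap between the sizes of `S` and `U`: revealing a vertex either enlarges `S`
    -- or shrinks `U`. The two branches give `t` at (∣S∣ + 1, 0) and at (∣S∣, 1), which the
    -- recurrence recombines. Quantifying over `t` allows the closed branch to use the shifted
    -- function.
    clusterSum-total : ∀ fuel {t} → Exploratory t → ∀ {S U} → ∣ U ∣ ≤ ∣ S ∣ ℕ.+ fuel →
                       S ⊆ U → Nonempty S → WeaklyConnected G S → clusterSum t S U ≈ t ∣ S ∣ 0
    clusterSum-total fuel {t} rec {S} {U} size S⊆U ne conn
      with any? (λ v → (v ∈? U) ×-dec isNeighbour? G S v)
    ... | no none = clusterSum-blocked t S⊆U ne conn (λ v∈U nb → none (_ , v∈U , nb))
    clusterSum-total zero {t} rec {S} {U} size S⊆U ne conn | yes (v , v∈U , nb) =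
      -- Without fuel `U` is no larger than `S`, yet `v` lies in `U` and not in `S`.
      contradiction (ℕ.≤-trans size (ℕ.≤-reflexive (ℕ.+-identityʳ _)))
        (ℕ.<⇒≱ (p⊂q⇒∣p∣<∣q∣ (S⊆U , v , v∈U , proj₁ nb)))
    clusterSum-total (suc fuel) {t} rec {S} {U} size S⊆U ne@(i , i∈S) conn | yes (v , v∈U , nb) = begin
      clusterSum t S U
        ≈⟨ explore rec v∈U nb ⟩
      clusterSum t (S ∪ ⁅ v ⁆) U + clusterSum (λ a b → t a (suc b)) S (U ∖ v)
        ≈⟨ +-cong (clusterSum-total fuel rec size₁ (∪⁅⁆⊆ S⊆U v∈U) (i , p⊆p∪q _ i∈S) (connected-∪ G conn nb))
                  (clusterSum-total fuel (λ a b → rec a (suc b)) size₂ S⊆U-v ne conn) ⟩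
      t (∣ S ∪ ⁅ v ⁆ ∣) 0 + t (∣ S ∣) 1
        ≡⟨ cong (λ s → t s 0 + t (∣ S ∣) 1) (∣p∪x∣ (proj₁ nb)) ⟩
      t (suc (∣ S ∣)) 0 + t (∣ S ∣) 1
        ≈⟨ rec (∣ S ∣) 0 ⟨
      t ∣ S ∣ 0 ∎
      where
      size₁ : ∣ U ∣ ≤ ∣ S ∪ ⁅ v ⁆ ∣ ℕ.+ fuel
      size₁ rewrite ∣p∪x∣ (proj₁ nb) | ≡.sym (ℕ.+-suc ∣ S ∣ fuel) = size
      size₂ : ∣ U ∖ v ∣ ≤ ∣ S ∣ ℕ.+ fuel
      size₂ = ℕ.s≤s⁻¹ (≡.subst₂ _≤_ (∣p∣≡suc∣p-x∣ v∈U) (ℕ.+-suc ∣ S ∣ fuel) size)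
      S⊆U-v : S ⊆ U ∖ v
      S⊆U-v x∈S = x∈p∧x≢y⇒x∈p-y (S⊆U x∈S) (λ { ≡.refl → proj₁ nb x∈S })

    -- The exploration starts with no vertex known to be closed: `U` is the full set, so all
    -- neighbours count, and `N` units of fuel bound its size.
    percolation : ∀ {t} → Exploratory t → ∀ {S} → Nonempty S → WeaklyConnected G S →
                  ⅀ 𝒞 (λ C → when (S ⊆? C) (t ∣ C ∣ ∣ neighbourhood G C ∣)) ≈ t ∣ S ∣ 0
    percolation {t} rec {S} ne conn = trans
      (⅀-cong 𝒞 (λ {C} _ → when-cong (S ⊆? C) (between? S ⊤ C) (λ S⊆C → S⊆C , ⊆⊤) proj₁
        (λ _ → reflexive (cong (t ∣ C ∣ ∘ ∣_∣) (≡.sym (∩-identityʳ (neighbourhood G C)))))))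
      (clusterSum-total N rec (ℕ.≤-trans (∣p∣≤n ⊤) (ℕ.m≤n+m N ∣ S ∣)) ⊆⊤ ne conn)

    -- Matrix powers as path sums

    module _ (ω : Labelling G Carrier) where

      private
        module L = Labelled rawRing G ω
        module 𝕄 = RawSemiringDefs (RawRing.rawSemiring (matrices rawRing N))
      open Digraph G

      W-arc : ∀ {i j} (e : E i j) → L.W i j ≡ ω e
      W-arc {i} {j} e with E? i j
      ... | yes e′ = cong ω (T-irrelevant e′ e)
      ... | no  ¬e = contradiction e ¬e

      W-non-arc : ∀ {i j} → ¬ E i j → L.W i j ≡ 0#
      W-non-arc {i} {j} ¬e with E? i j
      ... | yes e = contradiction e ¬e
      ... | no  _ = ≡.refl

      W∣ : Subset N → Matrix rawRing N
      W∣ C = restrict rawRing C L.W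

      -- The factors are entries of the restricted matrix, so a path whose arcs leave `C` acquires a
      -- zero factor.
      weightIn : ∀ {i j} → Subset N → Path G ℓ i j → Carrier
      weightIn C []                        = 1#
      weightIn C (_∷_ {i = i} {k = k} e p) = W∣ C i k * weightIn C p

      W∣-non-arc : ∀ C {i j} → ¬ E i j → W∣ C i j ≈ 0#
      W∣-non-arc C {i} {j} ¬e = case (i ∈? C) ×-dec (j ∈? C) of λ where
          (yes (i∈ , j∈)) → reflexive (≡.trans (restrict-in rawRing L.W i∈ j∈) (W-non-arc ¬e))
          (no ¬ij∈)       → reflexive (restrict-out rawRing L.W ¬ij∈)

      -- All paths of the graph are listed and `C` enters only through the weights. The index set is
      -- therefore the same for every `C`, and the sums over `C` and over paths can be exchanged.
      ^-paths : ∀ C ℓ i j → (W∣ C 𝕄.^ ℓ) i j ≈ ⅀ (paths G ℓ i j) (weightIn C)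
      ^-paths C zero i j with i ≟ j
      ... | yes ≡.refl = sym (+-identityʳ 1#)
      ... | no _       = refl
      ^-paths C (suc ℓ) i j = begin
        sum (λ k → W∣ C i k * (W∣ C 𝕄.^ ℓ) k j)
          ≈⟨ sum-cong-≋ {N} (λ k → trans (*-congˡ (^-paths C ℓ k j)) (prepend (E? i k))) ⟩
        sum (λ k → ⅀ (consPaths G (E? i k) (paths G ℓ k j)) (weightIn C))
          ≈⟨ ⅀-concatMap-tabulate (λ k → consPaths G (E? i k) (paths G ℓ k j)) id (weightIn C) ⟨
        ⅀ (paths G (suc ℓ) i j) (weightIn C) ∎
        where
        prepend : ∀ {k} {ps : List (Path G ℓ k j)} (d : Dec (E i k)) →
                  W∣ C i k * ⅀ ps (weightIn C) ≈ ⅀ (consPaths G d ps) (weightIn C)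
        prepend (no ¬e) = trans (*-congʳ (W∣-non-arc C ¬e)) (zeroˡ _)
        prepend {k} {ps} (yes e) = trans (*-distribˡ-⅀ (W∣ C i k) ps (weightIn C))
          (reflexive (cong (foldr _+_ 0#) (map-∘ ps)))

      weightIn-inside : ∀ {C i j} (p : Path G ℓ i j) → support (vertices G p) ⊆ C → weightIn C p ≈ L.weight p
      weightIn-inside []      ⊆C = refl
      weightIn-inside (e ∷ p) ⊆C = *-cong
        (reflexive (≡.trans
          (restrict-in rawRing L.W (⊆C (start∈support G (e ∷ p))) (⊆C (p⊆p∪q _ (start∈support G p))))
          (W-arc e)))
        (weightIn-inside p (⊆C ∘ p⊆p∪q _))

      -- In a path of positive length every vertex is an endpoint of an arc, so a vertex outside `C`
      -- forces a zero entry. The empty path has weight 1 even at a vertex outside `C`, so the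
      -- constant term needs separate treatment.
      weightIn-outside : ∀ {C i j} (p : Path G (suc ℓ) i j) → ¬ support (vertices G p) ⊆ C → weightIn C p ≈ 0#
      weightIn-outside {C = C} {i} (_∷_ {k = k} e p) ⊈C with (i ∈? C) ×-dec (k ∈? C)
      ... | no  _             = zeroˡ _
      weightIn-outside (e ∷ [])        ⊈C | yes (i∈ , j∈) = ⊥-elim (⊈C (∪⁅⁆⊆ (∪⁅⁆⊆ (⊥-elim ∘ ∉⊥) j∈) i∈))
      weightIn-outside (e ∷ p@(_ ∷ _)) ⊈C | yes (i∈ , _)  =
        trans (*-congˡ (weightIn-outside p (λ ⊆C → ⊈C (∪⁅⁆⊆ ⊆C i∈)))) (zeroʳ _)

      weightIn-when : ∀ C {i j} (p : Path G (suc ℓ) i j) →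
                      weightIn C p ≈ when (support (vertices G p) ⊆? C) (L.weight p)
      weightIn-when C p = case support (vertices G p) ⊆? C of λ where
          (yes ⊆C) → trans (weightIn-inside p ⊆C) (sym (when-yes (_ ⊆? C) ⊆C))
          (no ⊈C)  → trans (weightIn-outside p ⊈C) (sym (when-no (_ ⊆? C) ⊈C))

      -- After the exchange, a fixed path meets exactly the sets `C` that contain its vertex set.
      -- That set is non-empty and weakly connected, so `percolation` collapses the inner sum.
      percolate-paths : ∀ {t} → Exploratory t → ∀ ℓ i j →
        ⅀ 𝒞 (λ C → t ∣ C ∣ ∣ neighbourhood G C ∣ * (W∣ C 𝕄.^ suc ℓ) i j) ≈
        ⅀ (paths G (suc ℓ) i j) (λ p → t ∣ support (vertices G p) ∣ 0 * L.weight p)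
      percolate-paths {t} rec ℓ i j = begin
        ⅀ 𝒞 (λ C → τ C * (W∣ C 𝕄.^ suc ℓ) i j)
          ≈⟨ ⅀-cong 𝒞 (λ {C} _ → trans (*-congˡ (^-paths C (suc ℓ) i j)) (*-distribˡ-⅀ (τ C) ps (weightIn C))) ⟩
        ⅀ 𝒞 (λ C → ⅀ ps (λ p → τ C * weightIn C p))
          ≈⟨ ⅀-comm 𝒞 ps (λ C p → τ C * weightIn C p) ⟩
        ⅀ ps (λ p → ⅀ 𝒞 (λ C → τ C * weightIn C p))
          ≈⟨ ⅀-cong ps (λ {p} _ → collect p) ⟩
        ⅀ ps (λ p → t (∣ support (vertices G p) ∣) 0 * L.weight p) ∎
        where
        τ : Subset N → Carrier
        τ C = t ∣ C ∣ ∣ neighbourhood G C ∣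
        ps = paths G (suc ℓ) i j
        collect : ∀ p → ⅀ 𝒞 (λ C → τ C * weightIn C p) ≈ t ∣ support (vertices G p) ∣ 0 * L.weight p
        collect p = begin
          ⅀ 𝒞 (λ C → τ C * weightIn C p)
            ≈⟨ ⅀-cong 𝒞 (λ {C} _ → trans (*-congˡ (weightIn-when C p))
                 (trans (*-when (S ⊆? C) (τ C) (L.weight p)) (sym (when-* (S ⊆? C) (τ C) (L.weight p))))) ⟩
          ⅀ 𝒞 (λ C → when (S ⊆? C) (τ C) * L.weight p)
            ≈⟨ *-distribʳ-⅀ (L.weight p) 𝒞 (λ C → when (S ⊆? C) (τ C)) ⟨
          ⅀ 𝒞 (λ C → when (S ⊆? C) (τ C)) * L.weight p
            ≈⟨ *-congʳ (percolation rec (i , start∈support G p) (connected-support G p)) ⟩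
          t (∣ S ∣) 0 * L.weight p ∎
          where S = support (vertices G p)

      -- Summing over pairs i ∈ C reduces the count of singletons to percolation from each ⁅ i ⁆.
      count-clusters : ∀ {t} → Exploratory t →
        ⅀ 𝒞 (λ C → ∣ C ∣ · t ∣ C ∣ ∣ neighbourhood G C ∣) ≈ N · t 1 0
      count-clusters {t} rec = begin
        ⅀ 𝒞 (λ C → ∣ C ∣ · τ C)
          ≈⟨ ⅀-cong 𝒞 (λ {C} _ → sum-∈ C (τ C)) ⟨
        ⅀ 𝒞 (λ C → sum (λ i → when (i ∈? C) (τ C)))
          ≈⟨ sum-⅀-comm 𝒞 (λ i C → when (i ∈? C) (τ C)) ⟨
        sum (λ i → ⅀ 𝒞 (λ C → when (i ∈? C) (τ C)))
          ≈⟨ sum-cong-≋ {N} (λ i → trans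
               (⅀-cong 𝒞 (λ {C} _ → when-cong (i ∈? C) (⁅ i ⁆ ⊆? C)
                 (λ i∈C → λ x∈ → subst (_∈ C) (≡.sym (x∈⁅y⁆⇒x≡y i x∈)) i∈C)
                 (λ i⊆C → i⊆C (x∈⁅x⁆ i))
                 (λ _ → refl)))
               (trans (percolation rec (i , x∈⁅x⁆ i) (singleton-connected G i))
                 (reflexive (cong (λ s → t s 0) (∣⁅x⁆∣≡1 i))))) ⟩
        sum {N} (λ _ → t 1 0)
          ≈⟨ sum-replicate N ⟩
        N · t 1 0 ∎
        where
        τ : Subset N → Carrier
        τ C = t ∣ C ∣ ∣ neighbourhood G C ∣

      diag-diagonal : ∀ A i k → L.diag A i i k ≈ A i i k
      diag-diagonal A i k = reflexive (≡.cong-app (Diag-diagonal (powerSeries rawRing) A i) k)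

      diag-off-diagonal : ∀ A {i j} → i ≢ j → ∀ k → L.diag A i j k ≈ 0#
      diag-off-diagonal A i≢j k = reflexive (≡.cong-app (Diag-off-diagonal (powerSeries rawRing) A i≢j) k)

      ∑-coefficient : ∀ {A : Set a} (xs : List A) f i j k → L.∑ xs f i j k ≡ ⅀ xs (λ x → f x i j k)
      ∑-coefficient []       f i j k = ≡.refl
      ∑-coefficient (x ∷ xs) f i j k = cong (f x i j k +_) (∑-coefficient xs f i j k)

      ·-coefficient : ∀ n A i j k → (n L.· A) i j k ≡ n · A i j k
      ·-coefficient zero    A i j k = ≡.refl
      ·-coefficient (suc n) A i j k = cong (A i j k +_) (·-coefficient n A i j k)

      -- Coefficients of the open and closed terms

      openTerm closedTerm : Subset N → RawRing.Carrier L.𝕄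
      openTerm   C = (L.zW C L.^ (∣ C ∣ ∸ 1)) L.* ((L.I L.- L.zW C) L.^ ∣ neighbourhood G C ∣)
      closedTerm C = (L.zW C L.^ ∣ C ∣) L.* ((L.I L.- L.zW C) L.^ ∣ neighbourhood G C ∣)

      -- Reading one degree higher trades the exponent ∣C∣ - 1 for ∣C∣, the form to which the
      -- recurrence applies. Non-emptiness makes the truncated subtraction exact.
      openTerm-coefficient : ∀ {C} → Nonempty C → ∀ i j k →
        openTerm C i j k ≈ shift ∣ C ∣ ([1-z]^ ∣ neighbourhood G C ∣) (suc k) * (W∣ C 𝕄.^ k) i j
      openTerm-coefficient {C} ne i j k = trans (eval-product (W∣ C) (∣ C ∣ ∸ 1) ∣ neighbourhood G C ∣ i j k)
        (*-congʳ (reflexive (pred-shift (nonempty⇒∣p∣≡suc ne))))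
        where
        pred-shift : ∀ {m u} → ∃ (λ s → m ≡ suc s) → shift (m ∸ 1) u k ≡ shift m u (suc k)
        pred-shift (_ , ≡.refl) = ≡.refl

      closedTerm-sum : ∀ i j ℓ → ⅀ 𝒞 (λ C → closedTerm C i j (suc ℓ)) ≈
        ⅀ (paths G (suc ℓ) i j) (λ p → shift ∣ support (vertices G p) ∣ one (suc ℓ) * L.weight p)
      closedTerm-sum i j ℓ = trans
        (⅀-cong 𝒞 (λ {C} _ → eval-product (W∣ C) ∣ C ∣ ∣ neighbourhood G C ∣ i j (suc ℓ)))
        (percolate-paths (shift-exploratory (suc ℓ)) ℓ i j)

      openTerm-sum : ∀ i j ℓ → ⅀ 𝒞 (λ C → openTerm C i j (suc ℓ)) ≈
        ⅀ (paths G (suc ℓ) i j) (λ p → shift ∣ support (vertices G p) ∣ one (suc (suc ℓ)) * L.weight p)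
      openTerm-sum i j ℓ = trans
        (⅀-cong 𝒞 (λ C∈ → openTerm-coefficient (proj₁ (∈𝒞⁻ C∈)) i j (suc ℓ)))
        (percolate-paths (shift-exploratory (suc (suc ℓ))) ℓ i j)

      -- Only singletons have a constant term in the open formula, and each of the `N` singletons
      -- contributes the full identity matrix.
      openTerm-constant : ∀ i j → ⅀ 𝒞 (λ C → openTerm C i j 0) ≈ (N L.· L.I) i j 0
      openTerm-constant i j = begin
        ⅀ 𝒞 (λ C → openTerm C i j 0)
          ≈⟨ ⅀-cong 𝒞 (λ {C} C∈ → trans (openTerm-coefficient (proj₁ (∈𝒞⁻ C∈)) i j 0)
               (*-congʳ (multiple {u = [1-z]^ ∣ neighbourhood G C ∣} (nonempty⇒∣p∣≡suc (proj₁ (∈𝒞⁻ C∈)))))) ⟩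
        ⅀ 𝒞 (λ C → (∣ C ∣ · τ C) * identity rawRing i j)
          ≈⟨ *-distribʳ-⅀ (identity rawRing i j) 𝒞 (λ C → ∣ C ∣ · τ C) ⟨
        ⅀ 𝒞 (λ C → ∣ C ∣ · τ C) * identity rawRing i j
          -- The value of `t` at (1, 0) is the coefficient of z in z, which computes to `1#`.
          ≈⟨ *-congʳ (count-clusters (shift-exploratory 1)) ⟩
        (N · 1#) * identity rawRing i j
          ≈⟨ ×-assoc-* N 1# (identity rawRing i j) ⟩
        N · (1# * identity rawRing i j)
          ≈⟨ ×-congʳ N (one-*-identity i j 0) ⟨
        N · L.I i j 0
          ≡⟨ ·-coefficient N L.I i j 0 ⟨
        (N L.· L.I) i j 0 ∎
        where
        τ : Subset N → Carrier
        τ C = shift ∣ C ∣ ([1-z]^ ∣ neighbourhood G C ∣) 1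
        -- For positive `m` the coefficient of z vanishes unless m = 1, so multiplying it by `m`
        -- changes nothing. This inserts the factor ∣C∣ that `count-clusters` needs.
        multiple : ∀ {m u} → ∃ (λ s → m ≡ suc s) → shift m u 1 ≈ m · shift m u 1
        multiple (zero  , ≡.refl) = sym (+-identityʳ _)
        multiple {u = u} (suc s , ≡.refl) = sym (×-idem (+-identityˡ 0#) (suc (suc s)))

      -- Singling out the simple paths, and the two formulas

      P-zero : ∀ i j → L.P i j 0 ≈ 0#
      P-zero i j = trans (⅀-filter (simple? G) (paths G 0 i j) L.weight)
        -- The test `1 ≤ ℓ` fails by computation in length 0, so each summand already reduces to
        -- zero.
        (trans (⅀-cong (paths G 0 i j) (λ _ → refl)) (⅀-zero (paths G 0 i j)))

      -- The coefficient of z^k in z^(m p) is the indicator of m p = k. A statistic `m` that equals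
      -- `k` exactly on the simple paths thus turns the filter into a series coefficient.
      select-simple : ∀ {i j} (m : Path G (suc ℓ) i j → ℕ) {k} →
        (∀ p → m p ≡ k → Simple G p) → (∀ p → Simple G p → m p ≡ k) →
        L.P i j (suc ℓ) ≈ ⅀ (paths G (suc ℓ) i j) (λ p → shift (m p) one k * L.weight p)
      select-simple {ℓ} {i} {j} m {k} to from = trans (⅀-filter (simple? G) (paths G (suc ℓ) i j) L.weight)
        (⅀-cong (paths G (suc ℓ) i j) (λ {p} _ → select p (simple? G p)))
        where
        select : ∀ p (d : Dec (Simple G p)) → when d (L.weight p) ≈ shift (m p) one k * L.weight p
        select p (yes s) = sym (trans
          (*-congʳ (trans (reflexive (cong (λ s → shift s one k) (from p s))) (shift-one-≡ k)))
          (*-identityˡ _))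
        select p (no ¬s) = sym (trans (*-congʳ (shift-one-≢ (¬s ∘ to p))) (zeroˡ _))

      -- A path of length ℓ + 1 lists ℓ + 2 vertices, and its support reaches that size exactly when
      -- none repeats; this matches the degree read in `openTerm-sum`.
      P-open : ∀ {i j} → i ≢ j → ∀ ℓ → L.P i j (suc ℓ) ≈
        ⅀ (paths G (suc ℓ) i j) (λ p → shift ∣ support (vertices G p) ∣ one (suc (suc ℓ)) * L.weight p)
      P-open i≢j ℓ = select-simple (λ p → ∣ support (vertices G p) ∣)
        (λ p eq → s≤s z≤n ,
          (λ _ → ∣support∣≡length⇒unique (vertices G p) (≡.trans eq (≡.sym (length-vertices G p)))) ,
          (λ i≡j → contradiction i≡j i≢j))
        (λ p (_ , uniq , _) → ≡.trans (unique⇒∣support∣≡length (uniq i≢j)) (length-vertices G p))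

      -- For a cycle the repeated endpoint is dropped, so the critical size of the vertex set is the
      -- length itself.
      P-closed : ∀ i ℓ → L.P i i (suc ℓ) ≈
        ⅀ (paths G (suc ℓ) i i) (λ p → shift ∣ support (vertices G p) ∣ one (suc ℓ) * L.weight p)
      P-closed i ℓ = select-simple (λ p → ∣ support (vertices G p) ∣)
        (λ p eq → s≤s z≤n ,
          (λ i≢i → contradiction ≡.refl i≢i) ,
          (λ _ → ∣support∣≡length⇒unique (sources G p)
            (≡.trans (≡.trans (cong ∣_∣ (≡.sym (support-closed G p))) eq) (≡.sym (length-sources G p)))))
        (λ p (_ , _ , uniq) → ≡.trans (cong ∣_∣ (support-closed G p))
          (≡.trans (unique⇒∣support∣≡length (uniq ≡.refl)) (length-sources G p)))

      -- A closed path of length ℓ + 1 has at most ℓ + 1 distinct vertices, one fewer than the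
      -- coefficient asks for.
      openTerm-diagonal : ∀ i ℓ → ⅀ 𝒞 (λ C → openTerm C i i (suc ℓ)) ≈ 0#
      openTerm-diagonal i ℓ = trans (openTerm-sum i i ℓ)
        (trans (⅀-cong ps (λ {p} _ → trans (*-congʳ (shift-one-≢ (ℕ.<⇒≢ (s≤s (small p))))) (zeroˡ _))) (⅀-zero ps))
        where
        ps = paths G (suc ℓ) i i
        small : ∀ p → ∣ support (vertices G p) ∣ ≤ suc ℓ
        small p rewrite support-closed G p =
          ℕ.≤-trans (∣support∣≤length (sources G p)) (ℕ.≤-reflexive (length-sources G p))

      -- I is the full identity matrix, so each C = {k} with k ≠ i contributes 1 to the constant term
      -- at (i, i), and the C containing i contribute 1 in total: hence the correction N · I.
      open-formula : L.Pop L.≈ (L.∑ 𝒞 openTerm L.- (N L.· L.I))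
      open-formula i j k = begin
        L.P i j k + - L.Pcl i j k
          ≈⟨ coefficient k (i ≟ j) ⟩
        ⅀ 𝒞 (λ C → openTerm C i j k) + - (N L.· L.I) i j k
          ≡⟨ cong (_+ - (N L.· L.I) i j k) (∑-coefficient 𝒞 openTerm i j k) ⟨
        L.∑ 𝒞 openTerm i j k + - (N L.· L.I) i j k ∎
        where
        I-positive : ∀ {i j} n k → (n L.· L.I) i j (suc k) ≈ 0#
        I-positive zero    k = refl
        I-positive {i} {j} (suc n) k = trans
          (+-cong (trans (one-*-identity i j (suc k)) (zeroˡ _)) (I-positive n k))
          (+-identityˡ _)

        x-0≈x : ∀ {x y} → y ≈ 0# → x + - y ≈ x
        x-0≈x y≈0 = trans (+-congˡ (trans (-‿cong y≈0) -0#≈0#)) (+-identityʳ _)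

        coefficient : ∀ {i j} k → Dec (i ≡ j) → L.P i j k + - L.Pcl i j k ≈
                      ⅀ 𝒞 (λ C → openTerm C i j k) + - (N L.· L.I) i j k
        -- In degree 0 both sides vanish: on the right the constant terms cancel the correction, and
        -- on the left a simple path is non-empty or the diagonal is subtracted.
        coefficient {i} {j} zero d = trans (open₀ d)
          (sym (trans (+-congʳ (openTerm-constant i j)) (-‿inverseʳ _)))
          where
          open₀ : Dec (i ≡ j) → L.P i j 0 + - L.Pcl i j 0 ≈ 0#
          open₀ (yes ≡.refl) = trans (+-congˡ (-‿cong (diag-diagonal L.P i 0))) (-‿inverseʳ _)
          open₀ (no i≢j)     = trans (x-0≈x (diag-off-diagonal L.P i≢j 0)) (P-zero i j)
        coefficient {i} (suc ℓ) (yes ≡.refl) = trans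
          (trans (+-congˡ (-‿cong (diag-diagonal L.P i (suc ℓ)))) (-‿inverseʳ _))
          (sym (trans (x-0≈x (I-positive N ℓ)) (openTerm-diagonal i ℓ)))
        coefficient {i} {j} (suc ℓ) (no i≢j) = trans
          (trans (x-0≈x (diag-off-diagonal L.P i≢j (suc ℓ))) (trans (P-open i≢j ℓ) (sym (openTerm-sum i j ℓ))))
          (sym (x-0≈x (I-positive N ℓ)))

      -- On the diagonal, sets of size ℓ pick out the simple cycles of length ℓ. Off the diagonal
      -- the same coefficient would pick out open paths with exactly one repetition, and `diag`
      -- discards these.
      closed-formula : L.Pcl L.≈ L.∑ 𝒞 (λ C → L.diag (closedTerm C))
      closed-formula i j k = trans (coefficient k (i ≟ j))
        (reflexive (≡.sym (∑-coefficient 𝒞 (λ C → L.diag (closedTerm C)) i j k)))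
        where
        -- The factor z^∣C∣ with ∣C∣ positive leaves no constant term, so no correction arises here.
        closed₀ : ∀ {i C} → Nonempty C → closedTerm C i i 0 ≈ 0#
        closed₀ {i} {C} ne = trans (eval-product (W∣ C) ∣ C ∣ ∣ neighbourhood G C ∣ i i 0)
          (trans (*-congʳ (reflexive (constant {u = [1-z]^ ∣ neighbourhood G C ∣} (nonempty⇒∣p∣≡suc ne)))) (zeroˡ _))
          where
          constant : ∀ {m u} → ∃ (λ s → m ≡ suc s) → shift m u 0 ≡ 0#
          constant (_ , ≡.refl) = ≡.refl

        coefficient : ∀ {i j} k → Dec (i ≡ j) → L.Pcl i j k ≈ ⅀ 𝒞 (λ C → L.diag (closedTerm C) i j k)
        coefficient {i} {j} k (no i≢j) = trans (diag-off-diagonal L.P i≢j k)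
          (sym (trans (⅀-cong 𝒞 (λ {C} _ → diag-off-diagonal (closedTerm C) i≢j k)) (⅀-zero 𝒞)))
        coefficient {i} k (yes ≡.refl) = trans (diag-diagonal L.P i k)
          (trans (diagonal k) (⅀-cong 𝒞 (λ {C} _ → sym (diag-diagonal (closedTerm C) i k))))
          where
          diagonal : ∀ k → L.P i i k ≈ ⅀ 𝒞 (λ C → closedTerm C i i k)
          diagonal zero    = trans (P-zero i i)
            (sym (trans (⅀-cong 𝒞 (λ C∈ → closed₀ (proj₁ (∈𝒞⁻ C∈)))) (⅀-zero 𝒞)))
          diagonal (suc ℓ) = trans (P-closed i ℓ) (sym (closedTerm-sum i i ℓ))

theorem1 : ∀ {c r} (R : Ring c r) {N : ℕ} (G : Digraph N) (ω : Labelling G (Ring.Carrier R)) →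
    let open Labelled (Ring.rawRing R) G ω
        𝒞 = connectedSubsets G
        ν = λ C → ∣ neighbourhood G C ∣
    in
    (Pop ≈ (∑[ C ← 𝒞 ] (zW C ^ (∣ C ∣ ∸ 1) * (I - zW C) ^ ν C)) - N · I)
    ×
    (Pcl ≈ (∑[ C ← 𝒞 ] diag (zW C ^ ∣ C ∣ * (I - zW C) ^ ν C)))
theorem1 R G ω = open-formula R G ω , closed-formula R G ω
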